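{- Let $G$ be a finite simple $3$-connected cubic graph and let $x,y$ be two distinct vertices of $G$. If $x$ and $y$ are adjacent and $P$ is a longest $(x,y)$-path in $G$ (i.e., a path with endpoints $x$ and $y$ of maximum length among all such paths), then $P$ contains at least two internal $P$-bound vertices.
   Context: For a subgraph $H$ of a graph $G$, a vertex $v$ of $H$ is called $H$-bound if all neighbors of $v$ in $G$ lie in $H$, i.e., $N_G(v)\subseteq V(H)$. An internal vertex of a path is a vertex of the path that is not one of its endpoints. -}

module Defs where

open import Data.Nat using (ℕ; zero; suc; _+_; _≤_; _<_)
open import Data.Fin using (Fin)
open import Data.Bool using (Bool; true; false; if_then_else_)
open import Data.List using (List; []; _∷_; _++_; length; map; allFin)
open import Data.Nat.ListAction using (sum)
open import Data.List.Membership.Propositional using (_∈_; _∉_)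
open import Data.List.Relation.Unary.Linked using (Linked)
open import Data.List.Relation.Unary.Unique.Propositional using (Unique)
open import Data.Product using (Σ; _×_; ∃)
open import Relation.Binary.PropositionalEquality using (_≡_; _≢_)

record Graph (n : ℕ) : Set where
  field
    adj     : Fin n → Fin n → Bool
    symm    : ∀ u v → adj u v ≡ adj v u
    irrefl  : ∀ v → adj v v ≡ false

open Graph public

Adj : ∀ {n} → Graph n → Fin n → Fin n → Set
Adj G u v = adj G u v ≡ true

degree : ∀ {n} → Graph n → Fin n → ℕ
degree {n} G v = sum (map (λ u → if adj G v u then 1 else 0) (allFin n))

Cubic : ∀ {n} → Graph n → Set
Cubic G = ∀ v → degree G v ≡ 3

data WalkAvoiding {n} (G : Graph n) (S : List (Fin n)) : Fin n → Fin n → Set where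
  here : ∀ {a} → WalkAvoiding G S a a
  step : ∀ {a b c} → Adj G a b → b ∉ S → WalkAvoiding G S b c → WalkAvoiding G S a c

-- G is k-connected: more than k vertices, and G - S is connected for every
-- vertex set S with fewer than k vertices (S given as a list; |S| ≤ length S).
KConnected : ∀ {n} → ℕ → Graph n → Set
KConnected {n} k G =
  k < n ×
  (∀ (S : List (Fin n)) → length S < k →
     ∀ a b → a ∉ S → b ∉ S → WalkAvoiding G S a b)

pathVerts : ∀ {n} → Fin n → List (Fin n) → Fin n → List (Fin n)
pathVerts x mid y = x ∷ (mid ++ (y ∷ []))

IsPath : ∀ {n} → Graph n → Fin n → List (Fin n) → Fin n → Set
IsPath G x mid y = Unique (pathVerts x mid y) × Linked (Adj G) (pathVerts x mid y)

pathLength : ∀ {n} → List (Fin n) → ℕ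
pathLength mid = suc (length mid)

IsLongestPath : ∀ {n} → Graph n → Fin n → List (Fin n) → Fin n → Set
IsLongestPath G x mid y =
  IsPath G x mid y × (∀ mid' → IsPath G x mid' y → pathLength mid' ≤ pathLength mid)

Bound : ∀ {n} → Graph n → List (Fin n) → Fin n → Set
Bound G P v = ∀ u → Adj G v u → u ∈ P

{-# OPTIONS --safe #-}
module Submission where

open import Defs
open import Data.Bool using (Bool; true; false; _∧_; _xor_; if_then_else_)
import Data.Bool.Properties as Boolₚ
open import Data.Empty using (⊥; ⊥-elim)
open import Data.Fin using (Fin; zero; suc; toℕ; combine)
import Data.Fin.Properties as Finₚ
open import Data.List using (List; []; _∷_; _++_; [_]; length; map; filter; reverse; allFin; deduplicate)
import Data.List.Membership.DecPropositional as DecMembership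
open import Data.List.Membership.Propositional using (_∈_; _∉_)
import Data.List.Membership.Propositional.Properties as ∈ₚ
import Data.List.Properties as Listₚ
open import Data.List.Relation.Binary.Permutation.Propositional using (_↭_; prep; ↭⇒↭ₛ; ↭-sym; ↭-trans; ↭-refl)
import Data.List.Relation.Binary.Permutation.Propositional.Properties as ↭ₚ
import Data.List.Relation.Binary.Permutation.Setoid.Properties as ↭ₛₚ
open import Data.List.Relation.Unary.All using (All; []; _∷_)
import Data.List.Relation.Unary.All as All
open import Data.List.Relation.Unary.AllPairs using ([]; _∷_)
open import Data.List.Relation.Unary.Any using (here; there)
import Data.List.Relation.Unary.Any.Properties as Anyₚ
open import Data.List.Relation.Unary.Linked using (Linked; [-]; _∷_)
open import Data.List.Relation.Unary.Unique.Propositional using (Unique)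
import Data.List.Relation.Unary.Unique.DecPropositional.Properties as UniqueDecₚ
import Data.List.Relation.Unary.Unique.Propositional.Properties as Uniqueₚ
open import Data.Nat using (ℕ; zero; suc; _+_; _*_; _^_; _≤_; _<_; z≤n; s≤s)
open import Data.Nat.ListAction using (sum)
import Data.Nat.Properties as ℕₚ
open import Data.Product using (∃; ∃₂; _×_; _,_; proj₁; proj₂)
open import Data.Sum using (_⊎_; inj₁; inj₂; [_,_]′)
open import Data.Vec using (Vec; []; _∷_; replicate; zipWith)
import Data.Vec.Properties as Vecₚ
open import Function using (_∘_; case_of_)
open import Relation.Binary.PropositionalEquality
  using (_≡_; _≢_; refl; sym; trans; cong; cong₂; subst; subst₂; setoid)
open import Relation.Nullary using (¬_; Dec; yes; no; contradiction)
open import Relation.Nullary.Decidable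
  using (¬¬-excluded-middle; _×-dec_; _→-dec_; ¬?; does; dec-true; dec-false)

-- Suppose that at most one internal vertex of P is bound. Every other internal vertex has its third
-- neighbour outside P, and the components of G − P split these vertices into classes; by
-- 3-connectedness a class has at least three members. The path P has an independent set A of centres
-- meeting every class (an independent transversal, found by Sperner's lemma in the independence
-- complex of P), and A can avoid two prescribed vertices, namely the neighbours on P of the bound
-- vertex, whose third neighbour is an end of P.
-- Join each other vertex by a green edge to the centre of its class. Thomason's lollipop argument,
-- started at a centre p, gives a second Hamiltonian path of P plus green edges. If it uses exactly one
-- green edge at some centre, then rerouting its green edges through the components of G − P gives a
-- path longer than P. Otherwise the centres at which it uses two green edges form a smaller nonempty
-- set (p is not in it) to which the argument applies again.

-- The constants fit exactly. Filling a cycle of independent sets of size `s` in a path needs more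
-- than 3s available vertices. For k classes the last cycle has s = k - 1, so 3k - 2 vertices are
-- enough: classes of size three leave two vertices to spare, and a bound vertex has two neighbours
-- along P. Centres must avoid these two because, from the first centre on, every neighbour of a
-- centre along P has to carry a green edge. Then the vertex freed by cutting an edge at a centre
-- has exactly one further way to continue, and the lollipop walk is deterministic. Adjacency of `x`
-- and `y` closes P to a cycle. Hence every vertex of P, the ends included, has at most one
-- neighbour outside P and belongs to at most one class. The fixed end `y` of the rotations must
-- itself belong to a class; this is why the position of the bound vertex's third neighbour matters.

private variable
  V L : Set
  R S : V → V → Set
  a b c d u v w x y z : V
  l r r′ : List V
  n s : ℕ

-- Lists and paths

data Next {V : Set} : List V → V → V → Set where
  here  : Next (u ∷ v ∷ l) u v
  there : Next l u v → Next (w ∷ l) u v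

Red : List V → V → V → Set
Red l u v = Next l u v ⊎ Next l v u

Red-sym : Red l u v → Red l v u
Red-sym (inj₁ p) = inj₂ p
Red-sym (inj₂ p) = inj₁ p

Red-there : Red l u v → Red (w ∷ l) u v
Red-there (inj₁ p) = inj₁ (there p)
Red-there (inj₂ p) = inj₂ (there p)

Red-tail : u ≢ w → v ≢ w → Red (w ∷ l) u v → Red l u v
Red-tail n m (inj₁ here)      = contradiction refl n
Red-tail n m (inj₁ (there i)) = inj₁ i
Red-tail n m (inj₂ here)      = contradiction refl m
Red-tail n m (inj₂ (there i)) = inj₂ i

Next-∈ˡ : Next l u v → u ∈ l
Next-∈ˡ here      = here refl
Next-∈ˡ (there p) = there (Next-∈ˡ p)

Next-∈ʳ : Next l u v → v ∈ l
Next-∈ʳ here      = there (here refl)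
Next-∈ʳ (there p) = there (Next-∈ʳ p)

Red-∈ˡ : Red l u v → u ∈ l
Red-∈ˡ (inj₁ p) = Next-∈ˡ p
Red-∈ˡ (inj₂ p) = Next-∈ʳ p

Red-∈ʳ : Red l u v → v ∈ l
Red-∈ʳ = Red-∈ˡ ∘ Red-sym

Next-++ʳ : ∀ l → Next r u v → Next (l ++ r) u v
Next-++ʳ []      p = p
Next-++ʳ (x ∷ l) p = there (Next-++ʳ l p)

Next-++ˡ : Next l u v → Next (l ++ r) u v
Next-++ˡ here      = here
Next-++ˡ (there p) = there (Next-++ˡ p)

Red-++ʳ : ∀ l → Red r u v → Red (l ++ r) u v
Red-++ʳ l (inj₁ p) = inj₁ (Next-++ʳ l p)
Red-++ʳ l (inj₂ p) = inj₂ (Next-++ʳ l p)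

Red-++ˡ : Red l u v → Red (l ++ r) u v
Red-++ˡ (inj₁ p) = inj₁ (Next-++ˡ p)
Red-++ˡ (inj₂ p) = inj₂ (Next-++ˡ p)

Next-split : Next l u v → ∃₂ λ l₁ l₂ → l ≡ l₁ ++ u ∷ v ∷ l₂
Next-split here = [] , _ , refl
Next-split (there p) with l₁ , l₂ , refl ← Next-split p = _ ∷ l₁ , l₂ , refl

Unique-head : Unique (x ∷ l) → x ∉ l
Unique-head (p ∷ _) q = All.lookup p q refl

Unique-tail : Unique (x ∷ l) → Unique l
Unique-tail (_ ∷ p) = p

Unique-cons : x ∉ l → Unique l → Unique (x ∷ l)
Unique-cons p q = All.tabulate (λ { i refl → p i }) ∷ q

Unique-↭ : {l r : List V} → l ↭ r → Unique l → Unique r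
Unique-↭ p = ↭ₛₚ.Unique-resp-↭ (setoid _) (↭⇒↭ₛ p)

Unique-++ : Unique l → Unique r → (∀ {v} → v ∈ l → v ∈ r → ⊥) → Unique (l ++ r)
Unique-++ p q dis = Uniqueₚ.++⁺ p q (λ { (i , j) → dis i j })

Unique-++ʳ : ∀ (l : List V) → Unique (l ++ r) → Unique r
Unique-++ʳ []      p       = p
Unique-++ʳ (x ∷ l) (_ ∷ p) = Unique-++ʳ l p

Unique-++-disjoint : ∀ (l : List V) → Unique (l ++ r) → v ∈ l → v ∈ r → ⊥
Unique-++-disjoint (x ∷ l) p (here refl) j = Unique-head p (∈ₚ.∈-++⁺ʳ l j)
Unique-++-disjoint (x ∷ l) p (there i)   j = Unique-++-disjoint l (Unique-tail p) i j

Unique-⊆-length : {l r : List V} → Unique l → (∀ {v} → v ∈ l → v ∈ r) → length l ≤ length r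
Unique-⊆-length {l = []}    p s = z≤n
Unique-⊆-length {l = x ∷ l} p s with r₁ , r₂ , refl ← ∈ₚ.∈-∃++ (s (here refl)) =
  subst (suc (length l) ≤_) (sym (↭ₚ.↭-length (↭ₚ.shift x r₁ r₂)))
    (s≤s (Unique-⊆-length (Unique-tail p) sub))
  where
  sub : ∀ {v} → v ∈ l → v ∈ r₁ ++ r₂
  sub i with ↭ₚ.∈-resp-↭ (↭ₚ.shift x r₁ r₂) (s (there i))
  ... | here refl = contradiction i (Unique-head p)
  ... | there j   = j

Next-functional : Unique l → Next l u v → Next l u w → v ≡ w
Next-functional q here here = refl
Next-functional q here (there j) = contradiction (Next-∈ˡ j) (Unique-head q)
Next-functional q (there i) here = contradiction (Next-∈ˡ i) (Unique-head q)
Next-functional q (there i) (there j) = Next-functional (Unique-tail q) i j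

Next-not-first : Unique (v ∷ l) → Next (v ∷ l) u v → ⊥
Next-not-first q here      = Unique-head q (here refl)
Next-not-first q (there i) = Unique-head q (Next-∈ʳ i)

Next-injective : Unique l → Next l u w → Next l v w → u ≡ v
Next-injective q here here = refl
Next-injective q here (there j) = ⊥-elim (Next-not-first (Unique-tail q) j)
Next-injective q (there i) here = ⊥-elim (Next-not-first (Unique-tail q) i)
Next-injective q (there i) (there j) = Next-injective (Unique-tail q) i j

Next-asym : Unique l → Next l u v → Next l v u → ⊥
Next-asym q here j = Next-not-first q j
Next-asym q (there i) here = Next-not-first q (there i)
Next-asym q (there i) (there j) = Next-asym (Unique-tail q) i j

Red-third : Unique l → a ≢ b → Red l v a → Red l v b → Red l v c → c ≡ a ⊎ c ≡ b
Red-third q n (inj₁ i) (inj₁ j) _ = contradiction (Next-functional q i j) n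
Red-third q n (inj₂ i) (inj₂ j) _ = contradiction (Next-injective q i j) n
Red-third q n (inj₁ i) (inj₂ j) (inj₁ k) = inj₁ (Next-functional q k i)
Red-third q n (inj₁ i) (inj₂ j) (inj₂ k) = inj₂ (Next-injective q k j)
Red-third q n (inj₂ i) (inj₁ j) (inj₁ k) = inj₂ (Next-functional q k j)
Red-third q n (inj₂ i) (inj₁ j) (inj₂ k) = inj₁ (Next-injective q k i)

Next-pred : v ∈ l → ∃ λ u → Next (w ∷ l) u v
Next-pred (here refl) = _ , here
Next-pred (there i) with u , p ← Next-pred i = u , there p

data Path {V : Set} (R : V → V → Set) : V → V → List V → Set where
  stop : Path R a a [ a ]
  _▸_  : R a b → Path R b c l → Path R a c (a ∷ l)

infixr 5 _▸_

Path-first : Path R a b l → ∃ λ l′ → l ≡ a ∷ l′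
Path-first stop    = _ , refl
Path-first (_ ▸ _) = _ , refl

Path-head : Path R a b (c ∷ l) → a ≡ c
Path-head stop    = refl
Path-head (_ ▸ _) = refl

Path-∈-first : Path R a b l → a ∈ l
Path-∈-first stop    = here refl
Path-∈-first (_ ▸ _) = here refl

Path-∈-last : Path R a b l → b ∈ l
Path-∈-last stop    = here refl
Path-∈-last (_ ▸ p) = there (Path-∈-last p)

Path-last : Path R a b l → ∃ λ l′ → l ≡ l′ ++ [ b ]
Path-last stop = [] , refl
Path-last (_ ▸ p) with l′ , refl ← Path-last p = _ ∷ l′ , refl

Path-++ : Path R a b l → R b c → Path R c d r → Path R a d (l ++ r)
Path-++ stop    e q = e ▸ q
Path-++ (f ▸ p) e q = f ▸ Path-++ p e q

Path-∷ʳ : Path R a b l → R b c → Path R a c (l ++ [ c ])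
Path-∷ʳ p e = Path-++ p e stop

Path-reverse : (∀ {u v} → R u v → R v u) → Path R a b l → Path R b a (reverse l)
Path-reverse s stop = stop
Path-reverse {a = a} s (_▸_ {l = l} e p) =
  subst (Path _ _ _) (sym (Listₚ.unfold-reverse a l)) (Path-∷ʳ (Path-reverse s p) (s e))

Path-split : ∀ l → Path R a b ((d ∷ l) ++ c ∷ r) →
  ∃ λ e → Path R a e (d ∷ l) × R e c × Path R c b (c ∷ r)
Path-split [] (e ▸ p) with refl ← Path-head p = _ , stop , e , p
Path-split (x ∷ l) (e ▸ p) with d , q , f , p′ ← Path-split l p = d , e ▸ q , f , p′

Path-suffix : ∀ l → Path R a b (l ++ c ∷ r) → Path R c b (c ∷ r)
Path-suffix [] p with refl ← Path-head p = p
Path-suffix (x ∷ l) p with _ , _ , _ , q ← Path-split l p = q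

Path-Next : Path R a b l → Next l u v → R u v
Path-Next (e ▸ stop)    here = e
Path-Next (e ▸ (_ ▸ _)) here = e
Path-Next (_ ▸ p) (there q) = Path-Next p q

Path-map : (∀ {u v} → Next l u v → R u v → S u v) → Path R a b l → Path S a b l
Path-map f stop = stop
Path-map f (e ▸ stop) = f here e ▸ stop
Path-map f (e ▸ p@(_ ▸ _)) = f here e ▸ Path-map (f ∘ there) p

Path-succ : Path R a b l → v ∈ l → v ≢ b → ∃ λ w → Next l v w
Path-succ stop (here refl) n = contradiction refl n
Path-succ (e ▸ p) (here refl) n with _ , refl ← Path-first p = _ , here
Path-succ (e ▸ p) (there i) n with w , q ← Path-succ p i n = w , there q

Path-pred : Path R a b l → v ∈ l → v ≢ a → ∃ λ u → Next l u v
Path-pred p (here refl) n = contradiction (sym (Path-head p)) n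
Path-pred (e ▸ p) (there i) n = Next-pred i

Path-no-succ : Unique l → Path R a b l → Next l b v → ⊥
Path-no-succ q (_ ▸ p) here = Unique-head q (Path-∈-last p)
Path-no-succ q (_ ▸ p) (there i) = Path-no-succ (Unique-tail q) p i

Linked⇒Path : ∀ {x y : V} (l : List V) → Linked R (x ∷ l ++ [ y ]) → Path R x y (x ∷ l ++ [ y ])
Linked⇒Path []      (e ∷ [-]) = e ▸ stop
Linked⇒Path (z ∷ l) (e ∷ p)   = e ▸ Linked⇒Path l p

Path⇒Linked : Path R a b l → Linked R l
Path⇒Linked stop          = [-]
Path⇒Linked (e ▸ stop)    = e ∷ [-]
Path⇒Linked (e ▸ p@(_ ▸ _)) = e ∷ Path⇒Linked p

split-at-unique : ∀ {l l′ r r′ : List V} → Unique (l ++ c ∷ r) → l ++ c ∷ r ≡ l′ ++ c ∷ r′ → l ≡ l′ × r ≡ r′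
split-at-unique {l = []}    {[]}     q refl = refl , refl
split-at-unique {l = []}    {x ∷ l′} q refl = contradiction (∈ₚ.∈-++⁺ʳ l′ (here refl)) (Unique-head q)
split-at-unique {l = x ∷ l} {[]}     q refl = contradiction (∈ₚ.∈-++⁺ʳ l (here refl)) (Unique-head q)
split-at-unique {l = x ∷ l} {_ ∷ l′} q e with refl , e′ ← Listₚ.∷-injective e
  with refl , refl ← split-at-unique {l = l} {l′} (Unique-tail q) e′ = refl , refl

-- Alternating walks on a finite set

-- An alternating walk along two involutions α and ρ, started at a fixed point of ρ, can only
-- stop at another fixed point of ρ; stated for relations, with `Closing` the fixed points of ρ.
module Alternating {D : Set} (Valid Closing : D → Set) (α ρ : D → D → Set)
  (α-total : ∀ {d} → Valid d → ∃ λ e → α d e × Valid e)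
  (α-sym : ∀ {d e} → α d e → α e d)
  (α-functional : ∀ {d e f} → Valid d → α d e → α d f → e ≡ f)
  (α-irrefl : ∀ {d} → ¬ α d d)
  (ρ-total : ∀ {d} → Valid d → ¬ Closing d → ∃ λ e → ρ d e × Valid e)
  (ρ-sym : ∀ {d e} → ρ d e → ρ e d)
  (ρ-functional : ∀ {d e f} → Valid d → ρ d e → ρ d f → e ≡ f)
  (ρ-irrefl : ∀ {d} → Valid d → ¬ ρ d d)
  (ρ-open : ∀ {d e} → Valid d → ρ d e → ¬ Closing e)
  (N : ℕ) (code : D → Fin N) (code-injective : ∀ {d e} → Valid d → Valid e → code d ≡ code e → d ≡ e)
  (d₀ : D) (d₀-valid : Valid d₀) (d₀-closing : Closing d₀)
  (d₀-only : ∀ {d} → Valid d → Closing d → d ≡ d₀)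
  where

  data Trace : ℕ → D → Set where
    start : Trace 0 d₀
    step  : ∀ {i d e f} → Trace i d → α d e → Valid e → ρ e f → Valid f → Trace (suc i) f

  valid : ∀ {i d} → Trace i d → Valid d
  valid start = d₀-valid
  valid (step _ _ _ _ v) = v

  Trace-functional : ∀ {i d e} → Trace i d → Trace i e → d ≡ e
  Trace-functional start start = refl
  Trace-functional (step t a v r _) (step t′ a′ _ r′ _)
    with refl ← Trace-functional t t′
    with refl ← α-functional (valid t) a a′ = ρ-functional v r r′

  -- An α-edge between two positions folds the walk up: the steps between them are mirror images of
  -- each other, so both positions can be moved inwards until they coincide or are neighbours. This
  -- would be a fixed point of α or of ρ.
  no-reflection : ∀ k {j d e} → Trace (k + j) d → Trace j e → α d e → ⊥
  no-reflection zero t t′ a with refl ← Trace-functional t t′ = α-irrefl a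
  no-reflection (suc zero) (step t a′ _ r v) t′ a
    with refl ← Trace-functional t t′
    with refl ← α-functional (valid t) a′ (α-sym a) = ρ-irrefl v r
  no-reflection (suc (suc k)) {j} (step {d = d} t a′ v′ r v) t′ a =
    no-reflection k {suc j} (subst (λ i → Trace i d) (sym (ℕₚ.+-suc k j)) t)
      (step t′ (α-sym a) v (ρ-sym r) v′) a′

  extend : ∀ i → ∃ (Trace i)
  extend zero = d₀ , start
  extend (suc i)
    with d , t ← extend i
    with e , a , v ← α-total (valid t)
    -- A closing `e` would be `d₀`, and an α-edge back to the start is a reflection.
    with f , r , w ← ρ-total v (λ c →
      no-reflection i {0} (subst (λ j → Trace j d) (sym (ℕₚ.+-identityʳ i)) t) start (subst (α d) (d₀-only v c) a))
    = f , step t a v r w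

  -- Steps can be undone uniquely, so a repetition can be moved back to `d₀`, which no ρ-step
  -- enters.
  no-repetition : ∀ i k {d} → Trace i d → Trace (i + suc k) d → ⊥
  no-repetition zero k start (step _ _ v r _) = ρ-open v r d₀-closing
  no-repetition (suc i) k (step t a v r w) (step t′ a′ v′ r′ _)
    with refl ← ρ-functional w (ρ-sym r) (ρ-sym r′)
    with refl ← α-functional v (α-sym a) (α-sym a′) = no-repetition i k t t′

  absurd : ⊥
  absurd
    with i , j , i<j , e ← Finₚ.pigeonhole (ℕₚ.n<1+n N) (λ i → code (proj₁ (extend (toℕ i))))
    with k , eq ← ℕₚ.m≤n⇒∃[o]m+o≡n i<j
    with t ← proj₂ (extend (toℕ i))
    with t′ ← proj₂ (extend (toℕ j))
    = no-repetition (toℕ i) k t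
        (subst (λ m → Trace m _) (trans (sym eq) (sym (ℕₚ.+-suc (toℕ i) k)))
          (subst (Trace (toℕ j)) (sym (code-injective (valid t) (valid t′) e)) t′))

-- Digits to the base `suc n`, with zero for the places past the end of the list. Its purpose is
-- that lists of bounded length, hence the states of the lollipop walk, are finitely many.
encode : ∀ {n} k → List (Fin n) → Fin (suc n ^ k)
encode zero    _       = zero
encode {n} (suc k) []  = combine {suc n} zero (encode {n} k [])
encode     (suc k) (v ∷ l) = combine (suc v) (encode k l)

encode-injective : ∀ {n} k {l r : List (Fin n)} → length l ≤ k → length r ≤ k → encode k l ≡ encode k r → l ≡ r
encode-injective zero {[]} {[]} p q e = refl
encode-injective (suc k) {[]} {[]} p q e = refl
encode-injective {n} (suc k) {[]} {v ∷ r} p q e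
  with () ← Finₚ.combine-injectiveˡ zero (encode {n} k []) (suc v) (encode k r) e
encode-injective {n} (suc k) {u ∷ l} {[]} p q e
  with () ← Finₚ.combine-injectiveˡ (suc u) (encode k l) zero (encode {n} k []) e
encode-injective (suc k) {u ∷ l} {v ∷ r} (s≤s p) (s≤s q) e
  with e₁ , e₂ ← Finₚ.combine-injective (suc u) (encode k l) (suc v) (encode k r) e
  = cong₂ _∷_ (Finₚ.suc-injective e₁) (encode-injective k p q e₂)

-- Chains of independent sets of a path, over the field with two elements

Chain : ℕ → Set
Chain n = Vec Bool n → Bool

_≗_ : Chain n → Chain n → Set
z ≗ z′ = ∀ S → z S ≡ z′ S

infix 4 _≗_
infixl 6 _⊕_

_⊕_ : Chain n → Chain n → Chain n
(z ⊕ z′) S = z S xor z′ S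

𝟘 : Chain n
𝟘 _ = false

xor-interchange : ∀ a b c d → (a xor b) xor (c xor d) ≡ (a xor c) xor (b xor d)
xor-interchange false b false d = refl
xor-interchange false false true d = refl
xor-interchange false true true d = refl
xor-interchange true false false d = refl
xor-interchange true true false d = sym (Boolₚ.not-involutive d)
xor-interchange true false true d = Boolₚ.not-involutive d
xor-interchange true true true d = refl

xor-exchange : ∀ a b c → (a xor b) xor c ≡ (a xor c) xor b
xor-exchange a b c =
  trans (Boolₚ.xor-assoc a b c) (trans (cong (a xor_) (Boolₚ.xor-comm b c)) (sym (Boolₚ.xor-assoc a c b)))

xor-self : ∀ a → a xor a ≡ false
xor-self false = refl
xor-self true  = refl

xor-zero⇒≡ : ∀ a b → a xor b ≡ false → a ≡ b
xor-zero⇒≡ false false _ = refl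
xor-zero⇒≡ true  true  _ = refl

-- A boundary modulo 2 that removes only vertices of weight `true`. With weights `all` it is the
-- augmented simplicial boundary; with the indicator of a class it removes a vertex of that class.
-- Transversals are thereby counted by commuting operators of square zero.
∂ : Vec Bool n → Chain n → Chain n
∂ []      z []          = false
∂ (w ∷ b) z (false ∷ S) = ∂ b (λ T → z (false ∷ T)) S xor (w ∧ z (true ∷ S))
∂ (w ∷ b) z (true  ∷ S) = ∂ b (λ T → z (true ∷ T)) S

∂-cong : ∀ (b : Vec Bool n) {z z′} → z ≗ z′ → ∂ b z ≗ ∂ b z′
∂-cong []      e []          = refl
∂-cong (w ∷ b) e (false ∷ S) = cong₂ _xor_ (∂-cong b (λ T → e (false ∷ T)) S) (cong (w ∧_) (e (true ∷ S)))
∂-cong (w ∷ b) e (true  ∷ S) = ∂-cong b (λ T → e (true ∷ T)) S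

∂-⊕ : ∀ (b : Vec Bool n) z z′ → ∂ b (z ⊕ z′) ≗ ∂ b z ⊕ ∂ b z′
∂-⊕ []      z z′ []          = refl
∂-⊕ (w ∷ b) z z′ (false ∷ S) =
  trans (cong₂ _xor_ (∂-⊕ b _ _ S) (Boolₚ.∧-distribˡ-xor w (z (true ∷ S)) (z′ (true ∷ S))))
        (xor-interchange (∂ b (λ T → z (false ∷ T)) S) (∂ b (λ T → z′ (false ∷ T)) S)
          (w ∧ z (true ∷ S)) (w ∧ z′ (true ∷ S)))
∂-⊕ (w ∷ b) z z′ (true ∷ S) = ∂-⊕ b _ _ S

∂-𝟘 : ∀ (b : Vec Bool n) → ∂ b 𝟘 ≗ 𝟘
∂-𝟘 []      []          = refl
∂-𝟘 (w ∷ b) (false ∷ S) = cong₂ _xor_ (∂-𝟘 b S) (Boolₚ.∧-zeroʳ w)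
∂-𝟘 (w ∷ b) (true  ∷ S) = ∂-𝟘 b S

∂-∧ : ∀ (b : Vec Bool n) w z → ∂ b (λ T → w ∧ z T) ≗ (λ S → w ∧ ∂ b z S)
∂-∧ b false z = ∂-𝟘 b
∂-∧ b true  z _ = refl

-- Two vertices are removed in both orders, and the two contributions cancel.
∂-square : ∀ (b : Vec Bool n) z → ∂ b (∂ b z) ≗ 𝟘
∂-square []      z []          = refl
∂-square (w ∷ b) z (true  ∷ S) = ∂-square b _ S
∂-square (w ∷ b) z (false ∷ S)
  rewrite ∂-⊕ b (∂ b (λ T → z (false ∷ T))) (λ T → w ∧ z (true ∷ T)) S
        | ∂-square b (λ T → z (false ∷ T)) S
        | ∂-∧ b w (λ T → z (true ∷ T)) S
  = xor-self (w ∧ ∂ b (λ T → z (true ∷ T)) S)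

∂-comm : ∀ (b c : Vec Bool n) z → ∂ b (∂ c z) ≗ ∂ c (∂ b z)
∂-comm []      []      z []          = refl
∂-comm (w ∷ b) (x ∷ c) z (true  ∷ S) = ∂-comm b c _ S
∂-comm (w ∷ b) (x ∷ c) z (false ∷ S)
  rewrite ∂-⊕ b (∂ c (λ T → z (false ∷ T))) (λ T → x ∧ z (true ∷ T)) S
        | ∂-⊕ c (∂ b (λ T → z (false ∷ T))) (λ T → w ∧ z (true ∷ T)) S
        | ∂-∧ b x (λ T → z (true ∷ T)) S
        | ∂-∧ c w (λ T → z (true ∷ T)) S
        | ∂-comm b c (λ T → z (false ∷ T)) S
  = xor-exchange (∂ c (∂ b (λ T → z (false ∷ T))) S) _ _

∂-weight-⊕ : ∀ (b c : Vec Bool n) z → ∂ (zipWith _xor_ b c) z ≗ ∂ b z ⊕ ∂ c z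
∂-weight-⊕ []      []      z []          = refl
∂-weight-⊕ (w ∷ b) (x ∷ c) z (true  ∷ S) = ∂-weight-⊕ b c _ S
∂-weight-⊕ (w ∷ b) (x ∷ c) z (false ∷ S) =
  trans (cong₂ _xor_ (∂-weight-⊕ b c _ S) (Boolₚ.∧-distribʳ-xor (z (true ∷ S)) w x))
        (xor-interchange (∂ b (λ T → z (false ∷ T)) S) (∂ c (λ T → z (false ∷ T)) S)
          (w ∧ z (true ∷ S)) (x ∧ z (true ∷ S)))

∂-weight-𝟘 : ∀ (z : Chain n) → ∂ (replicate n false) z ≗ 𝟘
∂-weight-𝟘 z []          = refl
∂-weight-𝟘 z (false ∷ S) = cong (_xor false) (∂-weight-𝟘 _ S)
∂-weight-𝟘 z (true  ∷ S) = ∂-weight-𝟘 _ S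

block : Vec Bool n → Vec Bool n
block []      = []
block (_ ∷ b) = false ∷ b

-- Ok b S s: S is a set of s positions available in b, no two of them consecutive.
data Ok : Vec Bool n → Vec Bool n → ℕ → Set where
  []   : Ok [] [] 0
  skip : ∀ {c} {b S : Vec Bool n} → Ok b S s → Ok (c ∷ b) (false ∷ S) s
  pick : ∀ {b S : Vec Bool n} → Ok (block b) S s → Ok (true ∷ b) (true ∷ S) (suc s)

data _≼_ : Vec Bool n → Vec Bool n → Set where
  []   : [] ≼ []
  drop : ∀ {c} {a b : Vec Bool n} → a ≼ b → (false ∷ a) ≼ (c ∷ b)
  keep : ∀ {c} {a b : Vec Bool n} → a ≼ b → (c ∷ a) ≼ (c ∷ b)

≼-refl : ∀ (a : Vec Bool n) → a ≼ a
≼-refl []      = []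
≼-refl (c ∷ a) = keep (≼-refl a)

≼-block : ∀ {a b : Vec Bool n} → a ≼ b → block a ≼ block b
≼-block []       = []
≼-block (drop p) = keep p
≼-block (keep p) = keep p

block-≼ : ∀ (a : Vec Bool n) → block a ≼ a
block-≼ []      = []
block-≼ (_ ∷ a) = drop (≼-refl a)

Ok-mono : ∀ {a b S : Vec Bool n} → a ≼ b → Ok a S s → Ok b S s
Ok-mono [] [] = []
Ok-mono (drop p) (skip q) = skip (Ok-mono p q)
Ok-mono (keep p) (skip q) = skip (Ok-mono p q)
Ok-mono (keep p) (pick q) = pick (Ok-mono (≼-block p) q)

Ok-block₀ : ∀ {b S : Vec Bool n} → Ok b S 0 → Ok (block b) S 0
Ok-block₀ []       = []
Ok-block₀ (skip q) = skip q

Supported : Vec Bool n → ℕ → Chain n → Set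
Supported b s z = ∀ S → z S ≡ true → Ok b S s

count : Vec Bool n → ℕ
count []          = 0
count (false ∷ b) = count b
count (true  ∷ b) = suc (count b)

count-block : ∀ (b : Vec Bool n) → count b ≤ suc (count (block b))
count-block []          = z≤n
count-block (false ∷ b) = ℕₚ.n≤1+n _
count-block (true  ∷ b) = ℕₚ.≤-refl

all : Vec Bool n
all = replicate _ true

cone : Chain (suc n) → Chain (suc n)
cone z (false ∷ S) = false
cone z (true  ∷ S) = z (false ∷ S)

-- A chain of independent s-subsets of a path with more than 3s available vertices is a boundary as
-- soon as it is a cycle: pick an end vertex with a neighbour, push the chain off that neighbour
-- (which costs three vertices), and cone with the end vertex.
fill : ∀ n → Vec Bool n → ℕ → Chain n → Chain n
fill zero [] s z _ = false
fill (suc n) (false ∷ b) s z (false ∷ S) = fill n b s (λ T → z (false ∷ T)) S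
fill (suc n) (false ∷ b) s z (true  ∷ S) = false
fill (suc zero) (true ∷ []) s z = cone z
fill (suc (suc n)) (true ∷ false ∷ b) s z = cone z
fill (suc (suc n)) (true ∷ true ∷ b) zero z = cone z
fill (suc (suc n)) (true ∷ true ∷ b) (suc s) z (false ∷ false ∷ S) = false
fill (suc (suc n)) (true ∷ true ∷ b) (suc s) z (false ∷ true  ∷ S) =
  fill n (block b) s (λ T → z (false ∷ true ∷ T)) S
fill (suc (suc n)) (true ∷ true ∷ b) (suc s) z (true ∷ false ∷ S) =
  z (false ∷ false ∷ S) xor fill n (block b) s (λ T → z (false ∷ true ∷ T)) S
fill (suc (suc n)) (true ∷ true ∷ b) (suc s) z (true ∷ true ∷ S) = false

cone-∂ : ∀ (z : Chain (suc n)) → ∂ all z ≗ 𝟘 → ∂ all (cone z) ≗ z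
cone-∂ z cyc (false ∷ S) = cong (_xor z (false ∷ S)) (∂-𝟘 all S)
cone-∂ z cyc (true  ∷ S) = xor-zero⇒≡ _ _ (cyc (false ∷ S))

cone-supported : ∀ {b : Vec Bool n} {z} → (∀ {S} → Ok b S s → Ok (block b) S s) →
  Supported (true ∷ b) s z → Supported (true ∷ b) (suc s) (cone z)
cone-supported f sup (true ∷ S) e with skip q ← sup (false ∷ S) e = pick (f q)

≡false : ∀ {b} → (b ≡ true → ⊥) → b ≡ false
≡false {false} _ = refl
≡false {true}  f = ⊥-elim (f refl)

no-consecutive : ∀ {b S : Vec Bool n} → Ok (true ∷ true ∷ b) (true ∷ true ∷ S) s → ⊥
no-consecutive (pick ())

fill-supported : ∀ n (b : Vec Bool n) s {z} → Supported b s z → Supported b (suc s) (fill n b s z)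
fill-supported (suc n) (false ∷ b) s sup (false ∷ S) e =
  skip (fill-supported n b s (λ T e′ → case sup (false ∷ T) e′ of λ { (skip q) → q }) S e)
fill-supported (suc zero) (true ∷ []) s sup = cone-supported (λ q → q) sup
fill-supported (suc (suc n)) (true ∷ false ∷ b) s sup = cone-supported (λ q → q) sup
fill-supported (suc (suc n)) (true ∷ true ∷ b) zero sup = cone-supported Ok-block₀ sup
fill-supported (suc (suc n)) (true ∷ true ∷ b) (suc s) sup (false ∷ true ∷ S) e =
  skip (pick (fill-supported n (block b) s
    (λ T e′ → case sup (false ∷ true ∷ T) e′ of λ { (skip (pick q)) → q }) S e))
fill-supported (suc (suc n)) (true ∷ true ∷ b) (suc s) {z} sup (true ∷ false ∷ S) e
  with z (false ∷ false ∷ S) in eq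
... | true = case sup _ eq of λ { (skip (skip q)) → pick (skip q) }
... | false = pick (skip (Ok-mono (block-≼ b) (fill-supported n (block b) s
    (λ T e′ → case sup (false ∷ true ∷ T) e′ of λ { (skip (pick q)) → q }) S e)))

fill-∂ : ∀ n (b : Vec Bool n) s {z} → Supported b s z → ∂ all z ≗ 𝟘 → 3 * s < count b →
  ∂ all (fill n b s z) ≗ z
fill-∂ (suc n) (false ∷ b) s {z} sup cyc lt (false ∷ S) =
  trans (Boolₚ.xor-identityʳ _)
    (fill-∂ n b s (λ T e → case sup (false ∷ T) e of λ { (skip q) → q })
      (λ T → trans (sym (trans (cong (∂ all (λ U → z (false ∷ U)) T xor_)
          (≡false (λ e → case sup (true ∷ T) e of λ ()))) (Boolₚ.xor-identityʳ _))) (cyc (false ∷ T))) lt S)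
fill-∂ (suc n) (false ∷ b) s sup cyc lt (true ∷ S) =
  trans (∂-𝟘 all S) (sym (≡false (λ e → case sup (true ∷ S) e of λ ())))
fill-∂ (suc zero) (true ∷ []) s sup cyc lt = cone-∂ _ cyc
fill-∂ (suc (suc n)) (true ∷ false ∷ b) s sup cyc lt = cone-∂ _ cyc
fill-∂ (suc (suc n)) (true ∷ true ∷ b) zero sup cyc lt = cone-∂ _ cyc
fill-∂ (suc (suc n)) (true ∷ true ∷ b) (suc s) {z} sup cyc lt = go
  where
  z₁ y₁ : Chain n
  z₁ T = z (false ∷ true ∷ T)
  y₁ = fill n (block b) s z₁
  tt-false : ∀ T → z (true ∷ true ∷ T) ≡ false
  tt-false T = ≡false (λ e → no-consecutive (sup _ e))
  z₁-cyc : ∂ all z₁ ≗ 𝟘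
  z₁-cyc T = trans (sym (trans (cong (∂ all z₁ T xor_) (tt-false T)) (Boolₚ.xor-identityʳ _)))
    (cyc (false ∷ true ∷ T))
  -- v₁, v₂ and the blocked vertex after them cost at most three, as much as the step from `suc s`
  -- to `s` allows.
  lt′ : 3 * s < count (block b)
  lt′ = ℕₚ.+-cancelˡ-< 3 _ _ (subst (_< 3 + count (block b)) (ℕₚ.*-suc 3 s)
    (ℕₚ.<-≤-trans lt (s≤s (s≤s (count-block b)))))
  ∂y₁ : ∂ all y₁ ≗ z₁
  ∂y₁ = fill-∂ n (block b) s (λ T e → case sup (false ∷ true ∷ T) e of λ { (skip (pick q)) → q }) z₁-cyc lt′
  go : ∂ all (fill (suc (suc n)) (true ∷ true ∷ b) (suc s) z) ≗ z
  go (false ∷ false ∷ S) rewrite ∂-𝟘 all S with y₁ S | z (false ∷ false ∷ S)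
  ... | false | false = refl
  ... | false | true  = refl
  ... | true  | false = refl
  ... | true  | true  = refl
  go (false ∷ true ∷ S) = trans (Boolₚ.xor-identityʳ _) (∂y₁ S)
  go (true ∷ false ∷ S) =
    trans (Boolₚ.xor-identityʳ _)
      (trans (∂-⊕ all (λ T → z (false ∷ false ∷ T)) y₁ S)
        (trans (cong (∂ all (λ T → z (false ∷ false ∷ T)) S xor_) (∂y₁ S))
          (xor-zero⇒≡ _ _ (cyc (false ∷ false ∷ S)))))
  go (true ∷ true ∷ S) = trans (∂-𝟘 all S) (sym (tt-false S))

-- Boundary of the simplex on the labels

data Del {L : Set} : List L → List L → Set where
  here  : ∀ {j J} → Del (j ∷ J) J
  there : ∀ {j J K} → Del J K → Del (j ∷ J) (j ∷ K)

Del-length : ∀ {J K : List L} → Del J K → length J ≡ suc (length K)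
Del-length here      = refl
Del-length (there d) = cong suc (Del-length d)

Del-∈ : ∀ {J K : List L} {j} → Del J K → j ∈ K → j ∈ J
Del-∈ here      i         = there i
Del-∈ (there d) (here e)  = here e
Del-∈ (there d) (there i) = there (Del-∈ d i)

Del-unique : ∀ {J K : List L} → Del J K → Unique J → Unique K
Del-unique here      q = Unique-tail q
Del-unique (there d) q = Unique-cons (λ i → Unique-head q (Del-∈ d i)) (Del-unique d (Unique-tail q))

Del-missing : ∀ {J K : List L} → Unique J → Del J K → ∃ λ i → i ∈ J × i ∉ K
Del-missing q here = _ , here refl , Unique-head q
Del-missing q (there d) with i , i∈ , i∉ ← Del-missing (Unique-tail q) d =
  i , there i∈ , λ { (here refl) → Unique-head q i∈ ; (there j) → i∉ j }

-- The boundary of the simplex `J`, pushed forward by `f`.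
𝒟 : (List L → Chain n) → List L → Chain n
𝒟 f []      = 𝟘
𝒟 f (j ∷ J) = f J ⊕ 𝒟 (λ K → f (j ∷ K)) J

𝒟-cong : ∀ {f g : List L → Chain n} J → (∀ K → Del J K → f K ≗ g K) → 𝒟 f J ≗ 𝒟 g J
𝒟-cong []      e S = refl
𝒟-cong (j ∷ J) e S = cong₂ _xor_ (e J here S) (𝒟-cong J (λ K d → e (j ∷ K) (there d)) S)

𝒟-⊕ : ∀ (f g : List L → Chain n) J → 𝒟 (λ K → f K ⊕ g K) J ≗ 𝒟 f J ⊕ 𝒟 g J
𝒟-⊕ f g []      S = refl
𝒟-⊕ f g (j ∷ J) S =
  trans (cong ((f J S xor g J S) xor_) (𝒟-⊕ _ _ J S)) (xor-interchange (f J S) (g J S) _ _)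

𝒟-square : ∀ (f : List L → Chain n) J → 𝒟 (𝒟 f) J ≗ 𝟘
𝒟-square f []      S = refl
𝒟-square f (j ∷ J) S
  rewrite 𝒟-⊕ f (𝒟 (λ K → f (j ∷ K))) J S | 𝒟-square (λ K → f (j ∷ K)) J S
        | Boolₚ.xor-identityʳ (𝒟 f J S) = xor-self (𝒟 f J S)

𝒟-witness : ∀ {f : List L → Chain n} J S → 𝒟 f J S ≡ true → ∃ λ K → Del J K × f K S ≡ true
𝒟-witness {f = f} (j ∷ J) S e with f J S in eq
... | true  = J , here , eq
... | false with K , d , e′ ← 𝒟-witness J S e = j ∷ K , there d , e′

∂-𝒟 : ∀ (b : Vec Bool n) (f : List L → Chain n) J → ∂ b (𝒟 f J) ≗ 𝒟 (λ K → ∂ b (f K)) J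
∂-𝒟 b f []      S = ∂-𝟘 b S
∂-𝒟 b f (j ∷ J) S = trans (∂-⊕ b (f J) _ S) (cong (∂ b (f J) S xor_) (∂-𝒟 b _ J S))

-- Supports of chains, and weights given by predicates on vertices

∂-agree : ∀ (a c : Vec Bool n) {z} → (∀ S → z S ≡ true → zipWith _∧_ a S ≡ zipWith _∧_ c S) → ∂ a z ≗ ∂ c z
∂-agree []      []      e []          = refl
∂-agree (w ∷ a) (x ∷ c) e (true  ∷ S) = ∂-agree a c (λ T i → Vecₚ.∷-injectiveʳ (e (true ∷ T) i)) S
∂-agree (w ∷ a) (x ∷ c) {z} e (false ∷ S) =
  cong₂ _xor_ (∂-agree a c (λ T i → Vecₚ.∷-injectiveʳ (e (false ∷ T) i)) S) weights
  where
  weights : w ∧ z (true ∷ S) ≡ x ∧ z (true ∷ S)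
  weights with z (true ∷ S) in eq
  ... | true  = Vecₚ.∷-injectiveˡ (e (true ∷ S) eq)
  ... | false = trans (Boolₚ.∧-zeroʳ w) (sym (Boolₚ.∧-zeroʳ x))

≼-trans : ∀ {a b c : Vec Bool n} → a ≼ b → b ≼ c → a ≼ c
≼-trans []       []       = []
≼-trans (drop p) (drop q) = drop (≼-trans p q)
≼-trans (drop p) (keep q) = drop (≼-trans p q)
≼-trans (keep p) (drop q) = drop (≼-trans p q)
≼-trans (keep p) (keep q) = keep (≼-trans p q)

all-∧ : ∀ (S : Vec Bool n) → zipWith _∧_ all S ≡ S
all-∧ []      = refl
all-∧ (x ∷ S) = cong (x ∷_) (all-∧ S)

data Hit : Vec Bool n → Vec Bool n → Set where
  here  : ∀ {b S : Vec Bool n} → Hit (true ∷ b) (true ∷ S)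
  there : ∀ {c d} {b S : Vec Bool n} → Hit b S → Hit (c ∷ b) (d ∷ S)

Hit-mono : ∀ {b S T : Vec Bool n} → S ≼ T → Hit b S → Hit b T
Hit-mono (keep p) here      = here
Hit-mono (keep p) (there h) = there (Hit-mono p h)
Hit-mono (drop p) (there h) = there (Hit-mono p h)

∂-witness : ∀ (b : Vec Bool n) {z} S → ∂ b z S ≡ true → ∃ λ T → z T ≡ true × S ≼ T × Hit b T
∂-witness [] [] ()
∂-witness (w ∷ b) (true ∷ S) e with T , e′ , p , h ← ∂-witness b S e = true ∷ T , e′ , keep p , there h
∂-witness (w ∷ b) {z} (false ∷ S) e with ∂ b (λ T → z (false ∷ T)) S in eq
... | true with T , e′ , p , h ← ∂-witness b S eq = false ∷ T , e′ , drop p , there h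
∂-witness (true ∷ b) (false ∷ S) e | false = true ∷ S , e , drop (≼-refl S) , here

block-∧ : ∀ (b S : Vec Bool n) → zipWith _∧_ (block b) S ≡ S → zipWith _∧_ b S ≡ S
block-∧ []      []          e = refl
block-∧ (x ∷ b) (false ∷ S) e = cong₂ _∷_ (Boolₚ.∧-zeroʳ x) (Vecₚ.∷-injectiveʳ e)

Ok-∧ : ∀ {b S : Vec Bool n} → Ok b S s → zipWith _∧_ b S ≡ S
Ok-∧ []                       = refl
Ok-∧ (skip {c = c} q)         = cong₂ _∷_ (Boolₚ.∧-zeroʳ c) (Ok-∧ q)
Ok-∧ (pick {b = b} {S = S} q) = cong (true ∷_) (block-∧ b S (Ok-∧ q))

vmap : {A : Set} (f : A → Bool) (P : List A) → Vec Bool (length P)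
vmap f []      = []
vmap f (v ∷ P) = f v ∷ vmap f P

vmap-≼ : ∀ {A : Set} {f g : A → Bool} P → (∀ v → f v ≡ true → g v ≡ true) → vmap f P ≼ vmap g P
vmap-≼ [] h = []
vmap-≼ {f = f} {g} (v ∷ P) h with f v | h v
... | false | _ = drop (vmap-≼ P h)
... | true  | k rewrite k refl = keep (vmap-≼ P h)

vmap-xor : ∀ {A : Set} (f g : A → Bool) P → zipWith _xor_ (vmap f P) (vmap g P) ≡ vmap (λ v → f v xor g v) P
vmap-xor f g []      = refl
vmap-xor f g (v ∷ P) = cong (_ ∷_) (vmap-xor f g P)

vmap-false : ∀ {A : Set} (P : List A) → vmap (λ _ → false) P ≡ replicate (length P) false
vmap-false []      = refl
vmap-false (v ∷ P) = cong (false ∷_) (vmap-false P)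

∧-vmap-disjoint : ∀ {A : Set} (f g : A → Bool) P {S} → (∀ v → f v ≡ true → g v ≡ true → ⊥) →
  zipWith _∧_ (vmap g P) S ≡ S → zipWith _∧_ (vmap f P) S ≡ zipWith _∧_ (replicate _ false) S
∧-vmap-disjoint f g []      {[]}    h e = refl
∧-vmap-disjoint f g (v ∷ P) {x ∷ S} h e =
  cong₂ _∷_ (go (f v) (g v) x (h v) (Vecₚ.∷-injectiveˡ e)) (∧-vmap-disjoint f g P h (Vecₚ.∷-injectiveʳ e))
  where
  go : ∀ a b c → (a ≡ true → b ≡ true → ⊥) → b ∧ c ≡ c → a ∧ c ≡ false
  go false b     c     h e = refl
  go true  b     false h e = refl
  go true  true  true  h e = ⊥-elim (h refl refl)

data Sel {A : Set} : (P : List A) → Vec Bool (length P) → A → Set where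
  here  : ∀ {v P S} → Sel (v ∷ P) (true ∷ S) v
  there : ∀ {u v P c S} → Sel P S v → Sel (u ∷ P) (c ∷ S) v

Sel-∈ : ∀ {A : Set} {P : List A} {S v} → Sel P S v → v ∈ P
Sel-∈ here      = here refl
Sel-∈ (there s) = there (Sel-∈ s)

Hit-Sel : ∀ {A : Set} {f : A → Bool} P {S} → Hit (vmap f P) S → ∃ λ v → Sel P S v × f v ≡ true
Hit-Sel {f = f} (v ∷ P) h with f v in eq
Hit-Sel (v ∷ P) here | true = v , here , eq
Hit-Sel (v ∷ P) (there h) | _ with u , s , e ← Hit-Sel P h = u , there s , e

Ok-independent : ∀ {A : Set} {P : List A} {b S u v} → Unique P → Ok b S s → Next P u v →
  Sel P S u → Sel P S v → ⊥
Ok-independent q _ here _ (here) = Unique-head q (here refl)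
Ok-independent q _ here (there s) (there _) = Unique-head q (Sel-∈ s)
Ok-independent q (pick {b = _ ∷ _} ()) here here (there here)
Ok-independent q _ here here (there (there s)) = Unique-head (Unique-tail q) (Sel-∈ s)
Ok-independent q _ (there i) here _ = Unique-head q (Next-∈ˡ i)
Ok-independent q _ (there i) (there _) here = Unique-head q (Next-∈ʳ i)
Ok-independent q (skip k) (there i) (there s) (there t) = Ok-independent (Unique-tail q) k i s t
Ok-independent q (pick k) (there i) (there s) (there t) = Ok-independent (Unique-tail q) k i s t

-- Sperner's lemma for the independence complex of the path P: the chains Φ J, one for each set J
-- of labels, form a chain map from the simplex on the labels, and 𝓔 J counts the transversals of J.
module Transversal {A L : Set} (P : List A) (τ : L → A → Bool)
  (τ-disjoint : ∀ {i j} v → τ i v ≡ true → τ j v ≡ true → i ≡ j)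
  where

  -- For disjoint classes and lists without repetition `xor` agrees with disjunction, and it makes
  -- the weight additive in the list, as `∂-W-∷` requires.
  ω : List L → A → Bool
  ω []      v = false
  ω (j ∷ J) v = τ j v xor ω J v

  δ : L → Vec Bool (length P)
  δ j = vmap (τ j) P

  W : List L → Vec Bool (length P)
  W J = vmap (ω J) P

  ω-∈ : ∀ J {v} → ω J v ≡ true → ∃ λ j → j ∈ J × τ j v ≡ true
  ω-∈ (j ∷ J) {v} e with τ j v in eq
  ... | true = j , here refl , eq
  ... | false with i , i∈ , e′ ← ω-∈ J e = i , there i∈ , e′

  ω-∋ : ∀ {J j v} → Unique J → j ∈ J → τ j v ≡ true → ω J v ≡ true
  ω-∋ {j ∷ J} {_} {v} q (here refl) e rewrite e
    | ≡false {ω J v} (λ e′ → case ω-∈ J e′ of λ { (i , i∈ , f) →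
        Unique-head q (subst (_∈ J) (τ-disjoint v f e) i∈) }) = refl
  ω-∋ {h ∷ J} {_} {v} q (there i) e
    rewrite ≡false {τ h v} (λ f → Unique-head q (subst (_∈ J) (τ-disjoint v e f) i)) = ω-∋ (Unique-tail q) i e

  W-mono : ∀ {J K} → Unique J → (∀ {j} → j ∈ K → j ∈ J) → W K ≼ W J
  W-mono q s = vmap-≼ P (λ v e → case ω-∈ _ e of λ { (i , i∈ , f) → ω-∋ q (s i∈) f })

  ∅ : Vec Bool n
  ∅ = replicate _ false

  point : Chain n
  point []          = true
  point (false ∷ S) = point S
  point (true  ∷ S) = false

  point-∅ : ∀ n → point {n} ∅ ≡ true
  point-∅ zero    = refl
  point-∅ (suc n) = point-∅ n

  point-supported : (b : Vec Bool n) → Supported b 0 point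
  point-supported []      []          e = []
  point-supported (c ∷ b) (false ∷ S) e = skip (point-supported b S e)

  ∂-point : ∂ {n} all point ≗ 𝟘
  ∂-point []          = refl
  ∂-point (false ∷ S) = cong (_xor false) (∂-point S)
  ∂-point (true  ∷ S) = ∂-𝟘 all S

  -- Meant for lists of length `s`. The filling uses only vertices with labels in `J`, which is the
  -- boundary condition of Sperner's lemma.
  Φ : ℕ → List L → Chain (length P)
  Φ zero    J = point
  Φ (suc s) J = fill _ (W J) s (𝒟 (Φ s) J)

  𝓔 : List L → Chain (length P) → Chain (length P)
  𝓔 []      z = z
  𝓔 (j ∷ J) z = 𝓔 J (∂ (δ j) z)

  𝓔-cong : ∀ J {z z′} → z ≗ z′ → 𝓔 J z ≗ 𝓔 J z′
  𝓔-cong []      e = e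
  𝓔-cong (j ∷ J) e = 𝓔-cong J (∂-cong (δ j) e)

  𝓔-⊕ : ∀ J z z′ → 𝓔 J (z ⊕ z′) ≗ 𝓔 J z ⊕ 𝓔 J z′
  𝓔-⊕ []      z z′ S = refl
  𝓔-⊕ (j ∷ J) z z′ S = trans (𝓔-cong J (∂-⊕ (δ j) z z′) S) (𝓔-⊕ J _ _ S)

  𝓔-𝟘 : ∀ J → 𝓔 J 𝟘 ≗ 𝟘
  𝓔-𝟘 []      S = refl
  𝓔-𝟘 (j ∷ J) S = trans (𝓔-cong J (∂-𝟘 (δ j)) S) (𝓔-𝟘 J S)

  𝓔-kill : ∀ {J i z} → i ∈ J → ∂ (δ i) z ≗ 𝟘 → 𝓔 J z ≗ 𝟘
  𝓔-kill {_ ∷ J} (here refl) e S = trans (𝓔-cong J e S) (𝓔-𝟘 J S)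
  𝓔-kill {j ∷ J} {i} (there k) e =
    𝓔-kill k (λ S → trans (∂-comm (δ i) (δ j) _ S) (trans (∂-cong (δ j) e S) (∂-𝟘 (δ j) S)))

  𝓔-𝒟 : ∀ J (f : List L → Chain (length P)) K → (∀ K′ → Del K K′ → 𝓔 J (f K′) ≗ 𝟘) → 𝓔 J (𝒟 f K) ≗ 𝟘
  𝓔-𝒟 J f []      h S = 𝓔-𝟘 J S
  𝓔-𝒟 J f (k ∷ K) h S =
    trans (𝓔-⊕ J (f K) _ S) (cong₂ _xor_ (h K here S) (𝓔-𝒟 J _ K (λ K′ d → h (k ∷ K′) (there d)) S))

  ∂-W-∷ : ∀ j J z → ∂ (W (j ∷ J)) z ≗ ∂ (δ j) z ⊕ ∂ (W J) z
  ∂-W-∷ j J z S =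
    trans (cong (λ b → ∂ b z S) (sym (vmap-xor (τ j) (ω J) P))) (∂-weight-⊕ (δ j) (W J) z S)

  -- `∂ (W K)` is the sum of the `∂ (δ k)`; each of them occurs once more in `𝓔 J` and has square
  -- zero.
  𝓔-∂-W : ∀ J K z → (∀ {k} → k ∈ K → k ∈ J) → 𝓔 J (∂ (W K) z) ≗ 𝟘
  𝓔-∂-W J [] z h S = trans (𝓔-cong J (λ T → trans (cong (λ b → ∂ b z T) (vmap-false P)) (∂-weight-𝟘 z T)) S) (𝓔-𝟘 J S)
  𝓔-∂-W J (k ∷ K) z h S =
    trans (𝓔-cong J (∂-W-∷ k K z) S)
      (trans (𝓔-⊕ J _ _ S)
        (cong₂ _xor_ (𝓔-kill (h (here refl)) (∂-square (δ k) z) S) (𝓔-∂-W J K z (λ i → h (there i)) S)))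

  𝓔-witness : ∀ J z S → 𝓔 J z S ≡ true → ∃ λ T → z T ≡ true × S ≼ T × (∀ {j} → j ∈ J → Hit (δ j) T)
  𝓔-witness [] z S e = S , e , ≼-refl S , λ ()
  𝓔-witness (j ∷ J) z S e
    with T , e₁ , p , h ← 𝓔-witness J _ S e
    with U , e₂ , r , k ← ∂-witness (δ j) T e₁
    = U , e₂ , ≼-trans p r , λ { (here refl) → k ; (there i) → Hit-mono r (h i) }

  module _ (C : L → Set)
    (hall : ∀ J → Unique J → All C J → 3 * length J ≤ 2 + count (W J))
    where

    Φ-supported : ∀ s J → Unique J → Supported (W J) s (Φ s J)
    𝒟Φ-supported : ∀ s J → Unique J → Supported (W J) s (𝒟 (Φ s) J)
    Φ-supported zero    J q = point-supported (W J)
    Φ-supported (suc s) J q = fill-supported _ (W J) s (𝒟Φ-supported s J q)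
    𝒟Φ-supported s J q S e with K , d , e′ ← 𝒟-witness J S e =
      Ok-mono (W-mono q (Del-∈ d)) (Φ-supported s K (Del-unique d q) S e′)

    Del-All : ∀ {J K} → Del J K → All C J → All C K
    Del-All d c = All.tabulate (λ i → All.lookup c (Del-∈ d i))

    ∂-Φ : ∀ s J → Unique J → All C J → length J ≡ suc s → ∂ all (Φ (suc s) J) ≗ 𝒟 (Φ s) J
    𝒟Φ-cycle : ∀ s J → Unique J → All C J → length J ≡ suc s → ∂ all (𝒟 (Φ s) J) ≗ 𝟘
    -- For s + 1 labels `hall` reads 3s + 3 ≤ 2 + count, the strict inequality 3s < count that the
    -- filling needs.
    ∂-Φ s J q c l = fill-∂ _ (W J) s (𝒟Φ-supported s J q) (𝒟Φ-cycle s J q c l)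
      (ℕₚ.+-cancelˡ-≤ 2 _ _ (subst (_≤ 2 + count (W J)) (trans (cong (3 *_) l) (ℕₚ.*-suc 3 s)) (hall J q c)))
    𝒟Φ-cycle zero (j ∷ []) q c l S =
      trans (∂-cong all {z′ = point} (λ T → Boolₚ.xor-identityʳ (point T)) S) (∂-point S)
    𝒟Φ-cycle (suc s) J q c l S =
      trans (∂-𝒟 all (Φ (suc s)) J S)
        (trans (𝒟-cong J (λ K d → ∂-Φ s K (Del-unique d q) (Del-All d c)
            (ℕₚ.suc-injective (trans (sym (Del-length d)) l))) S)
          (𝒟-square (Φ s) J S))

    -- Sperner's induction. All vertices of φ carry labels of `j ∷ J`, so `∂ (δ j)` differs from the
    -- full boundary of φ by `∂ (W J)`, which `𝓔 J` annihilates. Of the full boundary it annihilates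
    -- every face except the one without `j`, since each other face lacks a label of `J`.
    𝓔-Φ : ∀ J → Unique J → All C J → 𝓔 J (Φ (length J) J) ∅ ≡ true
    𝓔-Φ [] q c = point-∅ (length P)
    𝓔-Φ (j ∷ J) q cs@(_ ∷ c) =
      trans (𝓔-cong J expand ∅)
        (trans (𝓔-⊕ J _ _ ∅)
          (trans (cong₂ _xor_
              (trans (𝓔-⊕ J _ _ ∅) (cong₂ _xor_ (𝓔-Φ J (Unique-tail q) c) (𝓔-𝒟 J (λ K → Φ (length J) (j ∷ K)) J missing ∅)))
              (𝓔-∂-W J J φ (λ i → i) ∅))
            refl))
      where
      φ = Φ (suc (length J)) (j ∷ J)
      expand : ∂ (δ j) φ ≗ 𝒟 (Φ (length J)) (j ∷ J) ⊕ ∂ (W J) φ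
      expand S = xor-move (∂ (δ j) φ S) (∂ (W J) φ S) (𝒟 (Φ (length J)) (j ∷ J) S)
        (trans (sym (∂-W-∷ j J φ S))
          (trans (∂-agree (W (j ∷ J)) all (λ T e → trans (Ok-∧ (Φ-supported (suc (length J)) (j ∷ J) q T e)) (sym (all-∧ T))) S)
            (∂-Φ (length J) (j ∷ J) q cs refl S)))
        where
        xor-move : ∀ a b c → a xor b ≡ c → a ≡ c xor b
        xor-move a b c refl = sym (trans (Boolₚ.xor-assoc a b b) (trans (cong (a xor_) (xor-self b)) (Boolₚ.xor-identityʳ a)))
      missing : ∀ K → Del J K → 𝓔 J (Φ (length J) (j ∷ K)) ≗ 𝟘
      missing K d with i , i∈ , i∉ ← Del-missing (Unique-tail q) d = 𝓔-kill i∈ (λ S →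
        trans (∂-agree (δ i) (replicate _ false) (λ T e →
            ∧-vmap-disjoint (τ i) (ω (j ∷ K)) P (λ v e₁ e₂ → case ω-∈ (j ∷ K) e₂ of λ
              { (k , here refl , f) → Unique-head q (subst (_∈ J) (τ-disjoint v e₁ f) i∈)
              ; (k , there k∈ , f) → i∉ (subst (_∈ K) (τ-disjoint v f e₁) k∈) })
              (Ok-∧ (Φ-supported (length J) (j ∷ K) (Del-unique (there d) q) T e))) S)
          (∂-weight-𝟘 _ S))

    transversal : Unique P → ∀ J → Unique J → All C J → ∃ λ (T : A → Set) →
      (∀ {j} → j ∈ J → ∃ λ v → v ∈ P × T v × τ j v ≡ true) × (∀ {u v} → Next P u v → T u → T v → ⊥)
    transversal uP J q c with S , e , _ , h ← 𝓔-witness J _ ∅ (𝓔-Φ J q c) =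
      Sel P S ,
      (λ i → case Hit-Sel P (h i) of λ { (v , s , f) → v , Sel-∈ s , s , f }) ,
      λ i → Ok-independent uP (Φ-supported (length J) J q S e) i

-- Rotations of a path

Next-++⁻ : ∀ l → Next (l ++ c ∷ r) u v → Next l u v ⊎ v ≡ c ⊎ Next (c ∷ r) u v
Next-++⁻ []          i         = inj₂ (inj₂ i)
Next-++⁻ (x ∷ [])    here      = inj₂ (inj₁ refl)
Next-++⁻ (x ∷ y ∷ l) here      = inj₁ here
Next-++⁻ (x ∷ l)     (there i) with Next-++⁻ l i
... | inj₁ j = inj₁ (there j)
... | inj₂ j = inj₂ j

Next-reverse : Next l u v → Next (reverse l) v u
Next-reverse {l = u ∷ v ∷ l} here
  rewrite Listₚ.unfold-reverse u (v ∷ l) | Listₚ.unfold-reverse v l | Listₚ.++-assoc (reverse l) [ v ] [ u ]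
  = Next-++ʳ (reverse l) here
Next-reverse {l = w ∷ l} (there i) rewrite Listₚ.unfold-reverse w l = Next-++ˡ (Next-reverse i)

Red-reverse : Red l u v → Red (reverse l) u v
Red-reverse (inj₁ i) = inj₂ (Next-reverse i)
Red-reverse (inj₂ i) = inj₁ (Next-reverse i)

third : Unique (a ∷ b ∷ c ∷ []) → x ∈ a ∷ b ∷ c ∷ [] → y ∈ a ∷ b ∷ c ∷ [] → x ≢ y →
  ∃ λ z → z ∈ a ∷ b ∷ c ∷ [] × z ≢ x × z ≢ y
third _ (here refl) (here refl) n = contradiction refl n
third ((_ ∷ ac ∷ []) ∷ (bc ∷ []) ∷ _) (here refl) (there (here refl)) n = _ , there (there (here refl)) , ac ∘ sym , bc ∘ sym
third ((ab ∷ _ ∷ []) ∷ (bc ∷ []) ∷ _) (here refl) (there (there (here refl))) n = _ , there (here refl) , ab ∘ sym , bc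
third ((_ ∷ ac ∷ []) ∷ (bc ∷ []) ∷ _) (there (here refl)) (here refl) n = _ , there (there (here refl)) , bc ∘ sym , ac ∘ sym
third _ (there (here refl)) (there (here refl)) n = contradiction refl n
third ((ab ∷ ac ∷ []) ∷ (_ ∷ []) ∷ _) (there (here refl)) (there (there (here refl))) n = _ , here refl , ab , ac
third ((ab ∷ _ ∷ []) ∷ (bc ∷ []) ∷ _) (there (there (here refl))) (here refl) n = _ , there (here refl) , bc , ab ∘ sym
third ((ab ∷ ac ∷ []) ∷ (_ ∷ []) ∷ _) (there (there (here refl))) (there (here refl)) n = _ , here refl , ac , ab
third _ (there (there (here refl))) (there (there (here refl))) n = contradiction refl n

no-fourth : x ∈ r → y ∈ r → z ∈ r → w ∈ r → length r ≡ 3 →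
  y ≢ x → z ≢ x → w ≢ x → y ≢ z → y ≢ w → z ≢ w → ⊥
no-fourth {x = x} {r = r} {y} {z} {w} i j k m e os ts qs ot oq tq =
  ℕₚ.1+n≰n (subst (4 ≤_) e (Unique-⊆-length {l = x ∷ y ∷ z ∷ w ∷ []}
    ((os ∘ sym ∷ ts ∘ sym ∷ qs ∘ sym ∷ []) ∷ (ot ∷ oq ∷ []) ∷ (tq ∷ []) ∷ [] ∷ [])
    (λ { (here refl) → i ; (there (here refl)) → j ; (there (there (here refl))) → k
       ; (there (there (there (here refl)))) → m })))

-- Thomason's lollipop argument. The path β is followed by p in a cycle; red edges are those of
-- p ∷ β, and a green edge joins each neighbour v of a centre (a vertex in A) to the centre g v.
-- Rotations only delete red edges at centres, so the free end always has exactly three neighbours.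
module SecondPath {n : ℕ} (A : Fin n → Set) (A? : ∀ v → Dec (A v)) (g : Fin n → Fin n)
  (p b₁ y : Fin n) (β : List (Fin n)) (uniq : Unique (p ∷ β))
  (β-path : Path (Red β) b₁ y β) (b₁≢y : b₁ ≢ y)
  (A-p : A p) (A-∈ : ∀ {a} → A a → a ∈ p ∷ β)
  (closed : ∀ {u v} → Red (p ∷ β) u v → A u → ¬ A v × A (g v))
  (apart : ∀ {u v a} → Red (p ∷ β) a v → A a → Red (p ∷ β) u v → g v ≢ u)
  where

  E : Fin n → Set
  E v = v ∈ β × ∃ λ a → A a × Red (p ∷ β) a v

  H : Fin n → Fin n → Set
  H u v = Red (p ∷ β) u v ⊎ (E u × g u ≡ v) ⊎ (E v × g v ≡ u)

  H-sym : ∀ {u v} → H u v → H v u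
  H-sym (inj₁ i)        = inj₁ (Red-sym i)
  H-sym (inj₂ (inj₁ i)) = inj₂ (inj₂ i)
  H-sym (inj₂ (inj₂ i)) = inj₂ (inj₁ i)

  E-¬A : ∀ {v} → E v → ¬ A v
  E-¬A (_ , a , Aa , i) = proj₁ (closed i Aa)

  E-g : ∀ {v} → E v → A (g v)
  E-g (_ , a , Aa , i) = proj₂ (closed i Aa)

  N : Fin n → Fin n → Set
  N e o = Red (p ∷ β) e o ⊎ g e ≡ o

  N⇒H : ∀ {e o} → E e → N e o → H e o
  N⇒H _ (inj₁ i) = inj₁ i
  N⇒H k (inj₂ i) = inj₂ (inj₁ (k , i))

  H⇒N : ∀ {e o} → ¬ A e → H e o → N e o
  H⇒N _ (inj₁ i)              = inj₁ i
  H⇒N _ (inj₂ (inj₁ (_ , i))) = inj₂ i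
  H⇒N n (inj₂ (inj₂ (k , refl))) = contradiction (E-g k) n

  H-A⇒E : ∀ {u v} → u ∈ β → H u v → A v → E u
  H-A⇒E u∈ (inj₁ i)              Av = u∈ , _ , Av , Red-sym i
  H-A⇒E u∈ (inj₂ (inj₁ (k , _))) Av = k
  H-A⇒E u∈ (inj₂ (inj₂ (k , _))) Av = contradiction Av (E-¬A k)

  neighbours : ∀ {e} → E e → e ≢ y → ∃ λ a → ∃ λ b → ∃ λ c →
    Unique (a ∷ b ∷ c ∷ []) × (∀ {o} → N e o → o ∈ a ∷ b ∷ c ∷ []) × (∀ {o} → o ∈ a ∷ b ∷ c ∷ [] → N e o)
  neighbours {e} k@(e∈ , a , Aa , i) e≢y
    with u , pr ← Next-pred {w = p} e∈
    with w , sc₀ ← Path-succ β-path e∈ e≢y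
    = u , w , g e ,
      ((u≢w ∷ apart i Aa (inj₁ pr) ∘ sym ∷ []) ∷ (apart i Aa (inj₂ sc) ∘ sym ∷ []) ∷ [] ∷ []) , to , from
    where
    sc = there sc₀
    u≢w : u ≢ w
    u≢w refl = Next-asym uniq pr sc
    to : ∀ {o} → N e o → o ∈ u ∷ w ∷ g e ∷ []
    to (inj₂ refl) = there (there (here refl))
    to (inj₁ i) with Red-third uniq u≢w (inj₂ pr) (inj₁ sc) i
    ... | inj₁ refl = here refl
    ... | inj₂ refl = there (here refl)
    from : ∀ {o} → o ∈ u ∷ w ∷ g e ∷ [] → N e o
    from (here refl)                 = inj₁ (inj₂ pr)
    from (there (here refl))         = inj₁ (inj₁ sc)
    from (there (there (here refl))) = inj₂ refl

  Dart : Set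
  Dart = List (Fin n) × Fin n

  -- The second component of a dart is a candidate for the next rotation of its path: ρ rotates, α
  -- passes to the other candidate, and the candidate `p` closes the path to `p ∷ M`. The invariant
  -- `kept` is what makes `option-A` true.
  record Valid (d : Dart) : Set where
    constructor dart
    field
      {e sec} : Fin n
      {M′}  : List (Fin n)
      shape : proj₁ d ≡ e ∷ sec ∷ M′
      path  : Path H e y (proj₁ d)
      perm  : proj₁ d ↭ β
      kept  : ∀ {u v} → Red β u v → ¬ A u → ¬ A v → Red (proj₁ d) u v
      end   : E e
      opt   : N e (proj₂ d)
      o≢s   : proj₂ d ≢ sec

  Valid-unique : ∀ {M o} → Valid (M , o) → Unique M
  Valid-unique v = Unique-↭ (↭-sym (Valid.perm v)) (Unique-tail uniq)

  ¬A⇒≢p : ∀ {v} → ¬ A v → v ≢ p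
  ¬A⇒≢p n refl = n A-p

  -- A red neighbour of the free end that is no centre is still next to it in the path by `kept`, so
  -- it is the second vertex. Only centres remain as candidates.
  option-A : ∀ {M o} → Valid (M , o) → A o
  option-A (dart _ _ _ _ end (inj₂ refl) _) = E-g end
  option-A {o = o} v@(dart refl path perm kept end (inj₁ i) o≢s) with A? o
  ... | yes a = a
  ... | no ¬a with kept (Red-tail (¬A⇒≢p (E-¬A end)) (¬A⇒≢p ¬a) i) (E-¬A end) ¬a
  ...   | inj₁ here      = contradiction refl o≢s
  ...   | inj₁ (there j) = contradiction (Next-∈ˡ j) (Unique-head (Valid-unique v))
  ...   | inj₂ j         = ⊥-elim (Next-not-first (Valid-unique v) j)

  end≢y : ∀ {M o} (v : Valid (M , o)) → Valid.e v ≢ y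
  end≢y v@(dart refl (_ ▸ q) _ _ _ _ _) refl = Unique-head (Valid-unique v) (Path-∈-last q)

  second-N : ∀ {M o} (v : Valid (M , o)) → N (Valid.e v) (Valid.sec v)
  second-N (dart refl (h ▸ q) _ _ end _ _) with refl ← Path-head q = H⇒N (E-¬A end) h

  Closing : Dart → Set
  Closing (M , o) = o ≡ p

  α : Dart → Dart → Set
  α d e = proj₁ d ≡ proj₁ e × proj₂ d ≢ proj₂ e × Valid d × Valid e

  α-total : ∀ {d} → Valid d → ∃ λ e → α d e × Valid e
  α-total {M , o} v@(dart refl path perm kept end opt o≢s)
    with _ , _ , _ , uq , to , from ← neighbours end (end≢y v)
    with t , t∈ , t≢s , t≢o ← third uq (to (second-N v)) (to opt) (o≢s ∘ sym)
    with w ← dart {d = M , t} refl path perm kept end (from t∈) t≢s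
    = (M , t) , (refl , t≢o ∘ sym , v , w) , w

  α-sym : ∀ {d e} → α d e → α e d
  α-sym (e , n , v , w) = sym e , n ∘ sym , w , v

  α-functional : ∀ {d e f} → Valid d → α d e → α d f → e ≡ f
  α-functional {_ , o} {M , t} {_ , q} v@(dart refl _ _ _ end opt o≢s)
    (refl , o≢t , _ , dart refl _ _ _ _ opt₁ t≢s) (refl , o≢q , _ , dart refl _ _ _ _ opt₂ q≢s)
    with _ , _ , _ , uq , to , _ ← neighbours end (end≢y v)
    with t Finₚ.≟ q
  ... | yes refl = refl
  ... | no t≢q = ⊥-elim (no-fourth (to (second-N v)) (to opt) (to opt₁) (to opt₂) refl o≢s t≢s q≢s o≢t o≢q t≢q)

  ρ : Dart → Dart → Set
  ρ (M , o) (M′ , o′) = o ≡ o′ × ∃₂ λ κ ν → M ≡ κ ++ o ∷ ν × M′ ≡ reverse κ ++ o ∷ ν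

  ρ-sym : ∀ {d e} → ρ d e → ρ e d
  ρ-sym (refl , κ , ν , refl , refl) =
    refl , reverse κ , ν , refl , cong (_++ _ ∷ ν) (sym (Listₚ.reverse-involutive κ))

  ρ-functional : ∀ {d e f} → Valid d → ρ d e → ρ d f → e ≡ f
  ρ-functional v (refl , κ , ν , refl , refl) (refl , κ′ , ν′ , eq , refl)
    with refl , refl ← split-at-unique {l = κ} {κ′} (Valid-unique v) eq = refl

  -- The candidate is a centre, so it is not the free end, and it is not the second vertex either.
  -- Hence the reversal moves at least two vertices and really changes the path.
  prefix-long : ∀ {κ o ν} → Valid (κ ++ o ∷ ν , o) → ∃ λ e → ∃ λ s → ∃ λ κ′ → κ ≡ e ∷ s ∷ κ′
  prefix-long {[]}        v@(dart refl _ _ _ end _ _) = contradiction (option-A v) (E-¬A end)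
  prefix-long {e ∷ []}    (dart refl _ _ _ _ _ o≢s)   = contradiction refl o≢s
  prefix-long {e ∷ s ∷ κ} v = e , s , κ , refl

  reverse-first : ∀ {e : Fin n} {κ M} → reverse (e ∷ κ) ≡ e ∷ M → κ ≢ [] → e ∈ κ
  reverse-first {e} {κ} eq κ≢[] with reverse κ in eq′ | trans (sym (Listₚ.unfold-reverse e κ)) eq
  ... | []    | _    = contradiction (trans (sym (Listₚ.reverse-involutive κ)) (cong reverse eq′)) κ≢[]
  ... | x ∷ r | refl = Anyₚ.reverse⁻ (subst (e ∈_) (sym eq′) (here refl))

  ρ-irrefl : ∀ {d} → Valid d → ¬ ρ d d
  ρ-irrefl v (refl , κ , ν , refl , eq)
    with e , s , κ′ , refl ← prefix-long {κ} v
    with eq′ , _ ← split-at-unique {l = κ} {reverse κ} (Valid-unique v) eq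
    = Unique-head (Valid-unique v) (∈ₚ.∈-++⁺ˡ (reverse-first {κ = s ∷ κ′} (sym eq′) (λ ())))

  ∈-state : ∀ {M o} → Valid (M , o) → p ∉ M
  ∈-state v i = Unique-head uniq (↭ₚ.∈-resp-↭ (Valid.perm v) i)

  ρ-open : ∀ {d e} → Valid d → ρ d e → ¬ Closing e
  ρ-open v (refl , κ , ν , refl , refl) refl = ∈-state v (∈ₚ.∈-++⁺ʳ κ (here refl))

  ρ-total : ∀ {d} → Valid d → ¬ Closing d → ∃ λ e → ρ d e × Valid e
  ρ-total {M , o} v o≢p
    with A-∈ (option-A v)
  ... | here refl = contradiction refl o≢p
  ... | there o∈β
    with κ , ν , refl ← ∈ₚ.∈-∃++ (↭ₚ.∈-resp-↭ (↭-sym (Valid.perm v)) o∈β)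
    with e , s , κ′ , refl ← prefix-long {κ} v
    with dart refl path perm kept end opt o≢s ← v
    with c , q₁ , h , q₂ ← Path-split (s ∷ κ′) path
    with r , rev ← Path-first (Path-reverse H-sym q₁)
    = (reverse κ ++ o ∷ ν , o) , (refl , κ , ν , refl , refl) ,
      go r rev
    where
    A-o = option-A v
    κ↭ : reverse κ ++ o ∷ ν ↭ β
    κ↭ = ↭-trans (↭ₚ.++⁺ʳ (o ∷ ν) (↭ₚ.↭-reverse κ)) perm
    c∈κ = Path-∈-last q₁
    c∈β : c ∈ β
    c∈β = ↭ₚ.∈-resp-↭ perm (∈ₚ.∈-++⁺ˡ c∈κ)
    -- The cut edge ends at the centre `o`; this puts the new free end into `E`.
    E-c : E c
    E-c = H-A⇒E c∈β h A-o
    flip-Next : ∀ {u v} → ¬ A u → ¬ A v → Next (κ ++ o ∷ ν) u v → Red (reverse κ ++ o ∷ ν) u v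
    flip-Next nu nv i with Next-++⁻ κ i
    ... | inj₁ j           = Red-++ˡ (Red-reverse (inj₁ j))
    ... | inj₂ (inj₁ refl) = contradiction A-o nv
    ... | inj₂ (inj₂ j)    = inj₁ (Next-++ʳ (reverse κ) j)
    kept′ : ∀ {u v} → Red β u v → ¬ A u → ¬ A v → Red (reverse κ ++ o ∷ ν) u v
    kept′ i nu nv with kept i nu nv
    ... | inj₁ j = flip-Next nu nv j
    ... | inj₂ j = Red-sym (flip-Next nv nu j)
    path′ : Path H c y (reverse κ ++ o ∷ ν)
    path′ = Path-++ (Path-reverse H-sym q₁) (N⇒H end opt) q₂
    go : ∀ r → reverse κ ≡ c ∷ r → Valid (reverse κ ++ o ∷ ν , o)
    go [] rev with () ← trans (sym (Listₚ.length-reverse κ)) (cong length rev)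
    go (x ∷ r) rev = dart (cong (_++ o ∷ ν) rev) path′ κ↭ kept′ E-c (H⇒N (E-¬A E-c) h)
      λ { refl → Unique-++-disjoint κ (Valid-unique v)
            (Anyₚ.reverse⁻ (subst (o ∈_) (sym rev) (there (here refl)))) (here refl) }

  β-valid : Valid (β , p)
  β-valid = go β-path refl
    where
    go : ∀ {l} → Path (Red β) b₁ y l → l ≡ β → Valid (β , p)
    go stop eq = contradiction refl b₁≢y
    go (_ ▸ q) eq with _ , refl ← Path-first q | refl ← eq = dart refl (Path-map (λ _ → inj₁ ∘ Red-there) β-path) ↭-refl
      (λ i _ _ → i) (here refl , p , A-p , inj₁ here) (inj₁ (inj₂ here)) λ { refl → Unique-head uniq (there (here refl)) }

  -- A dart with candidate `p` gives a path `p ∷ M`. If all of these were `p ∷ β`, the alternating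
  -- walk from that dart would have nowhere to stop.
  second-path : ¬ (∀ {M} → M ↭ β → Path H p y (p ∷ M) → M ≡ β)
  second-path only = Alternating.absurd Valid Closing α ρ α-total α-sym
    (λ {d} {e} {f} → α-functional {d} {e} {f}) (λ { (_ , n , _) → n refl })
    ρ-total (λ {d} {e} → ρ-sym {d} {e}) (λ {d} {e} {f} → ρ-functional {d} {e} {f}) ρ-irrefl
    (λ {d} {e} → ρ-open {d} {e})
    _ (λ { (M , o) → combine (encode (length β) M) o })
    (λ { {M , o} {M′ , o′} v w eq → code-injective v w (Finₚ.combine-injective (encode (length β) M) o (encode (length β) M′) o′ eq) })
    (β , p) β-valid refl
    λ { v refl → cong (_, p) (only (Valid.perm v)
          (N⇒H′ v ▸ Valid.path v)) }
    where
    N⇒H′ : ∀ {M} (v : Valid (M , p)) → H p (Valid.e v)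
    N⇒H′ v = H-sym (N⇒H (Valid.end v) (Valid.opt v))
    code-injective : ∀ {M o M′ o′} → Valid (M , o) → Valid (M′ , o′) →
      encode (length β) M ≡ encode (length β) M′ × o ≡ o′ → (M , o) ≡ (M′ , o′)
    code-injective v w (e₁ , refl) = cong (_, _) (encode-injective (length β)
      (ℕₚ.≤-reflexive (↭ₚ.↭-length (Valid.perm v))) (ℕₚ.≤-reflexive (↭ₚ.↭-length (Valid.perm w))) e₁)

-- From green edges to paths of the graph

-- A path W on the vertices of P all of whose edges are edges of the graph or green is turned into a
-- path of the graph. A green edge from v to its centre c is replaced by a detour through the class
-- of c outside P; if both edges of W at c are green, the detour bypasses c. So the path gets longer
-- unless no centre is incident with exactly one green edge of W.
module Lift {V L : Set} (Adj : V → V → Set) (P : List V) (Out : V → Set) (ℓ : V → L)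
  (bridge : ∀ {u v} → Out u → Out v → ℓ u ≡ ℓ v → ∃ λ κ → ∃ λ k → ∃ λ k′ →
    Path Adj k k′ κ × Adj u k × Adj k′ v × Unique κ × (∀ {w} → w ∈ κ → w ∉ P × ℓ w ≡ ℓ u))
  (A : V → Set) (A-injective : ∀ {a b} → A a → A b → ℓ a ≡ ℓ b → a ≡ b) (A-Out : ∀ {a} → A a → Out a)
  (Green : V → V → Set)
  (Green-ends : ∀ {u v} → Green u v → (A v × ¬ A u × Out u × ℓ u ≡ ℓ v) ⊎ (A u × ¬ A v × Out v × ℓ v ≡ ℓ u))
  where

  Link : V → V → Set
  Link u v = (Adj u v × ¬ Green u v) ⊎ Green u v

  -- The flag tells whether the edge entering the first vertex of the list is green.
  data NonMixed : Bool → List V → Set where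
    last  : ∀ {f e} → (A e → f ≡ false) → NonMixed f [ e ]
    plain : ∀ {f e e′ W} → ¬ Green e e′ → (A e → f ≡ false) → NonMixed false (e′ ∷ W) → NonMixed f (e ∷ e′ ∷ W)
    green : ∀ {f e e′ W} → Green e e′ → (A e → f ≡ true) → NonMixed true (e′ ∷ W) → NonMixed f (e ∷ e′ ∷ W)

  -- `from u` is a green edge from `u` into a centre with its detour postponed: only the next edge
  -- decides whether the detour ends at the centre or bypasses it.
  data Entry : Bool → V → Set where
    direct : ∀ {f e} → (A e → f ≡ false) → Entry f e
    from   : ∀ {e} u → A e → Out u → ℓ u ≡ ℓ e → Entry true e

  Start : ∀ {f e} → Entry f e → V → Set
  Start {e = e} (direct _)     h = h ≡ e
  Start         (from u _ _ _) h = Adj u h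

  -- Keeps detours disjoint: each is charged to the unique centre of its class, which `W` visits
  -- once.
  Owned : List V → V → Set
  Owned W q = q ∈ W ⊎ (q ∉ P × ∃ λ c → c ∈ W × A c × ℓ q ≡ ℓ c)

  Owned-there : ∀ {W e q} → Owned W q → Owned (e ∷ W) q
  Owned-there (inj₁ i)               = inj₁ (there i)
  Owned-there (inj₂ (n , c , i , k)) = inj₂ (n , c , there i , k)

  record Lifted {f e} (entry : Entry f e) (y : V) (W : List V) : Set where
    constructor lifted
    field
      {h}    : V
      {Q}    : List V
      path   : Path Adj h y Q
      starts : Start entry h
      unique : Unique Q
      owned  : ∀ {q} → q ∈ Q → Owned W q
      longer : length W < length Q ⊎ (length W ≤ length Q × NonMixed f W)

  ≤-length : ∀ {f W} {Q : List V} → length W < length Q ⊎ (length W ≤ length Q × NonMixed f W) → length W ≤ length Q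
  ≤-length (inj₁ lt)       = ℕₚ.<⇒≤ lt
  ≤-length (inj₂ (le , _)) = le

  private
    module Step {e : V} {W Q : List V} (uW : Unique (e ∷ W)) (W⊆P : ∀ {v} → v ∈ e ∷ W → v ∈ P)
      (uQ : Unique Q) (owned : ∀ {q} → q ∈ Q → Owned W q) where

      e∉Q : e ∉ Q
      e∉Q i with owned i
      ... | inj₁ j       = Unique-head uW j
      ... | inj₂ (n , _) = n (W⊆P (here refl))

      eQ : Unique (e ∷ Q)
      eQ = Unique-cons e∉Q uQ

      eQ-owned : ∀ {q} → q ∈ e ∷ Q → Owned (e ∷ W) q
      eQ-owned (here refl) = inj₁ (here refl)
      eQ-owned (there i)   = Owned-there (owned i)

      module _ {κ : List V} {a : L} (uκ : Unique κ) (κ-class : ∀ {w} → w ∈ κ → w ∉ P × ℓ w ≡ a)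
        (Ae : A e) (a≡ : a ≡ ℓ e) where

        κ-disjoint : ∀ {v} → v ∈ κ → v ∈ e ∷ Q → ⊥
        κ-disjoint i (here refl) = proj₁ (κ-class i) (W⊆P (here refl))
        κ-disjoint i (there j) with owned j
        ... | inj₁ k = proj₁ (κ-class i) (W⊆P (there k))
        ... | inj₂ (_ , c , k , Ac , eq)
          with refl ← A-injective Ac Ae (trans (sym eq) (trans (proj₂ (κ-class i)) a≡)) = Unique-head uW k

        κ-owned : ∀ {q} → q ∈ κ → Owned (e ∷ W) q
        κ-owned i = inj₂ (proj₁ (κ-class i) , e , here refl , Ae , trans (proj₂ (κ-class i)) a≡)

        κQ : Unique (κ ++ Q)
        κQ = Unique-++ uκ uQ (λ i j → κ-disjoint i (there j))

        κQ-owned : ∀ {q} → q ∈ κ ++ Q → Owned (e ∷ W) q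
        κQ-owned i with ∈ₚ.∈-++⁻ κ i
        ... | inj₁ j = κ-owned j
        ... | inj₂ j = Owned-there (owned j)

        κeQ : Unique (κ ++ e ∷ Q)
        κeQ = Unique-++ uκ eQ κ-disjoint

        κeQ-owned : ∀ {q} → q ∈ κ ++ e ∷ Q → Owned (e ∷ W) q
        κeQ-owned i with ∈ₚ.∈-++⁻ κ i
        ... | inj₁ j = κ-owned j
        ... | inj₂ j = eQ-owned j

        eκQ : Unique (e ∷ κ ++ Q)
        eκQ = Unique-cons
          (λ i → [ (λ j → κ-disjoint j (here refl)) , e∉Q ]′ (∈ₚ.∈-++⁻ κ i)) κQ

        eκQ-owned : ∀ {q} → q ∈ e ∷ κ ++ Q → Owned (e ∷ W) q
        eκQ-owned (here refl) = inj₁ (here refl)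
        eκQ-owned (there i)   = κQ-owned i

    detour-length : ∀ {a b} {κ Q : List V} → Path Adj a b κ → suc (length Q) ≤ length (κ ++ Q)
    detour-length {κ = κ} {Q} p with κ′ , refl ← Path-first p =
      s≤s (subst (length Q ≤_) (sym (Listₚ.length-++ κ′)) (ℕₚ.m≤n+m _ _))

  lift : ∀ {f e y W} (entry : Entry f e) → Path Link e y W → Unique W → (∀ {v} → v ∈ W → v ∈ P) →
    Lifted entry y W
  lift {e = e} (direct ne) stop uW W⊆P =
    lifted stop refl uW inj₁ (inj₂ (ℕₚ.≤-refl , last ne))
  lift {e = e} (from u Ae Ou eq) stop uW W⊆P
    with κ , k , k′ , p , a₁ , a₂ , uκ , cls ← bridge Ou (A-Out Ae) eq =
    lifted (Path-++ p a₂ stop) a₁ (κeQ uκ cls Ae eq) (κeQ-owned uκ cls Ae eq)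
      (inj₁ (detour-length p))
    where open Step {e} {[]} {[]} uW W⊆P [] (λ ())
  lift {f} {e} (direct ne) (inj₁ (adj , ng) ▸ q) uW W⊆P
    with W′ , refl ← Path-first q
    with lifted {Q = Q} path refl uQ owned longer ← lift {false} (direct (λ _ → refl)) q (Unique-tail uW) (λ i → W⊆P (there i)) =
    lifted (adj ▸ path) refl eQ eQ-owned
      ([ (λ lt → inj₁ (s≤s lt)) , (λ { (le , nm) → inj₂ (s≤s le , plain ng ne nm) }) ]′ longer)
    where open Step uW W⊆P uQ owned
  lift {e = e} (from u Ae Ou eq) (inj₁ (adj , ng) ▸ q) uW W⊆P
    with W′ , refl ← Path-first q
    with κ , k , k′ , p , a₁ , a₂ , uκ , cls ← bridge Ou (A-Out Ae) eq
    with lifted {Q = Q} path refl uQ owned longer ← lift {false} (direct (λ _ → refl)) q (Unique-tail uW) (λ i → W⊆P (there i)) =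
    lifted (Path-++ p a₂ (adj ▸ path)) a₁ (κeQ uκ cls Ae eq) (κeQ-owned uκ cls Ae eq)
      (inj₁ (ℕₚ.≤-trans (s≤s (s≤s (≤-length {Q = Q} longer))) (detour-length p)))
    where open Step uW W⊆P uQ owned
  lift {f} {e} entry (inj₂ gr ▸ q) uW W⊆P with Green-ends gr | entry
  ... | inj₁ (_ , ¬Ae , _ , _) | from u Ae _ _ = contradiction Ae ¬Ae
  ... | inj₁ (Ae′ , ¬Ae , Oe , eq) | direct ne
    with W′ , refl ← Path-first q
    with lifted path adj uQ owned longer ← lift (from e Ae′ Oe eq) q (Unique-tail uW) (λ i → W⊆P (there i)) =
    lifted (adj ▸ path) refl eQ eQ-owned
      ([ (λ lt → inj₁ (s≤s lt))
       , (λ { (le , nm) → inj₂ (s≤s le , green gr (λ Ae → contradiction Ae ¬Ae) nm) }) ]′ longer)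
    where open Step uW W⊆P uQ owned
  lift {f} {e} entry (inj₂ gr ▸ q) uW W⊆P | inj₂ (Ae , ¬Ae′ , Oe′ , eq) | direct ne
    with W′ , refl ← Path-first q
    with κ , k , k′ , p , a₁ , a₂ , uκ , cls ← bridge (A-Out Ae) Oe′ (sym eq)
    with lifted {Q = Q} path refl uQ owned longer ← lift {true} (direct (λ Ae′ → contradiction Ae′ ¬Ae′)) q (Unique-tail uW) (λ i → W⊆P (there i)) =
    lifted (a₁ ▸ Path-++ p a₂ path) refl (eκQ uκ cls Ae refl) (eκQ-owned uκ cls Ae refl)
      (inj₁ (s≤s (ℕₚ.≤-trans (s≤s (≤-length {Q = Q} longer)) (detour-length p))))
    where open Step uW W⊆P uQ owned
  -- The detour takes the place of `e` and has at least one vertex, so no length is lost.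
  lift {f} {e} entry (inj₂ gr ▸ q) uW W⊆P | inj₂ (Ae , ¬Ae′ , Oe′ , eq) | from u _ Ou eq′
    with W′ , refl ← Path-first q
    with κ , k , k′ , p , a₁ , a₂ , uκ , cls ← bridge Ou Oe′ (trans eq′ (sym eq))
    with lifted {Q = Q} path refl uQ owned longer ← lift {true} (direct (λ Ae′ → contradiction Ae′ ¬Ae′)) q (Unique-tail uW) (λ i → W⊆P (there i)) =
    lifted (Path-++ p a₂ path) a₁ (κQ uκ cls Ae eq′) (κQ-owned uκ cls Ae eq′)
      ([ (λ lt → inj₁ (ℕₚ.≤-trans (s≤s lt) (detour-length p)))
       , (λ { (le , nm) → inj₂ (ℕₚ.≤-trans (s≤s le) (detour-length p) , green gr (λ _ → refl) nm) }) ]′ longer)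
    where open Step uW W⊆P uQ owned

  NonMixed-Next : ∀ {f W u a v} → NonMixed f W → Next W u a → Next W a v → A a → Unique W →
    (Green u a → Green a v) × (Green a v → Green u a)
  NonMixed-Next _ here here _ uW = ⊥-elim (Unique-head uW (here refl))
  NonMixed-Next (plain ng _ (plain ng′ _ _)) here (there here) _ _ = (λ g → contradiction g ng) , λ g → contradiction g ng′
  NonMixed-Next (plain _ _ (green _ k _)) here (there here) Aa _ = case k Aa of λ ()
  NonMixed-Next (green _ _ (plain _ k _)) here (there here) Aa _ = case k Aa of λ ()
  NonMixed-Next (green g _ (green g′ _ _)) here (there here) _ _ = (λ _ → g′) , λ _ → g
  NonMixed-Next _ here (there (there j)) _ uW = contradiction (Next-∈ˡ j) (Unique-head (Unique-tail uW))
  NonMixed-Next _ (there i) here _ uW = contradiction (Next-∈ʳ i) (Unique-head uW)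
  NonMixed-Next (plain _ _ nm) (there i) (there j) Aa uW = NonMixed-Next nm i j Aa (Unique-tail uW)
  NonMixed-Next (green _ _ nm) (there i) (there j) Aa uW = NonMixed-Next nm i j Aa (Unique-tail uW)

  NonMixed-first : ∀ {a v W} → NonMixed false (a ∷ W) → A a → Next (a ∷ W) a v → Unique (a ∷ W) → ¬ Green a v
  NonMixed-first (plain ng _ _) Aa here _ g = ng g
  NonMixed-first (green _ k _)  Aa here _ g = case k Aa of λ ()
  NonMixed-first _ Aa (there i) uW g = Unique-head uW (Next-∈ˡ i)

  NonMixed-last : ∀ {f u v y W} → Unique W → NonMixed f W → A y → Path Link u y W → Next W v y → ¬ Green v y
  NonMixed-last uW _                    Ay stop          (there ())
  NonMixed-last uW (plain ng _ _)       Ay (_ ▸ stop)    here g = ng g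
  NonMixed-last uW (green _ _ (last k)) Ay (_ ▸ stop)    here g = case k Ay of λ ()
  NonMixed-last uW nm                   Ay (_ ▸ (_ ▸ q)) here g = Unique-head (Unique-tail uW) (Path-∈-last q)
  NonMixed-last uW (plain _ _ nm)       Ay (_ ▸ q)       (there i) g = NonMixed-last (Unique-tail uW) nm Ay q i g
  NonMixed-last uW (green _ _ nm)       Ay (_ ▸ q)       (there i) g = NonMixed-last (Unique-tail uW) nm Ay q i g

-- Longest paths with a system of centres

-- Since the final goal is `⊥`, predicates without a decision procedure at hand, such as
-- reachability outside P, may be treated as decidable.
¬¬-Fin : ∀ {n} {P : Fin n → Set} → (∀ i → ¬ ¬ P i) → ¬ ¬ (∀ i → P i)
¬¬-Fin {zero}  f k = k (λ ())
¬¬-Fin {suc n} f k = f zero (λ p₀ → ¬¬-Fin (f ∘ suc) (λ ps → k (λ { zero → p₀ ; (suc i) → ps i })))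

Path-split-after : ∀ l → Path R a b (l ++ u ∷ v ∷ r) → Path R a u (l ++ [ u ]) × R u v × Path R v b (v ∷ r)
Path-split-after [] (e ▸ q) with refl ← Path-head q = stop , e , q
Path-split-after (x ∷ []) (e ▸ q) with q₁ , f , q₂ ← Path-split-after [] q = e ▸ q₁ , f , q₂
Path-split-after (x ∷ l@(_ ∷ _)) (e ▸ q) with q₁ , f , q₂ ← Path-split-after l q = e ▸ q₁ , f , q₂

Path-replace : ∀ l → Path R a b (l ++ c ∷ r) → (∀ {u v} → u ∈ l → R u v → S u v) →
  Path S c b (c ∷ r′) → Path S a b (l ++ c ∷ r′)
Path-replace []      q       h q′ with refl ← Path-head q = q′
Path-replace (x ∷ [])        (e ▸ q) h q′ = h (here refl) e ▸ Path-replace [] q (h ∘ there) q′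
Path-replace (x ∷ l@(_ ∷ _)) (e ▸ q) h q′ = h (here refl) e ▸ Path-replace l q (h ∘ there) q′

-- The only edge of `p ∷ β` at `p` leads to the head of `β`; the rest follows after removing `p`.
Red-rigid : ∀ {p : V} {β} M → Unique (p ∷ β) → Unique (p ∷ M) → M ↭ β →
  (∀ {u v} → Next (p ∷ M) u v → Red (p ∷ β) u v) → M ≡ β
Red-rigid [] _ _ M↭β _ = sym (↭ₚ.↭-empty-inv (↭-sym M↭β))
Red-rigid {p = p} (e ∷ M) uβ uM M↭β red with red here
... | inj₁ (there j) = contradiction (Next-∈ˡ j) (Unique-head uβ)
... | inj₂ j         = ⊥-elim (Next-not-first uβ j)
... | inj₁ here      = cong (e ∷_) (Red-rigid M (Unique-tail uβ) (Unique-tail uM) (↭ₚ.drop-∷ M↭β)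
  λ j → Red-tail (λ { refl → Unique-head uM (Next-∈ˡ j) }) (λ { refl → Unique-head uM (Next-∈ʳ j) }) (red (there j)))

first-satisfying : ∀ {B : V → Set} → (∀ v → Dec (B v)) → ∀ {b} l → b ∈ l → B b →
  ∃ λ γ → ∃ λ p → ∃ λ δ → l ≡ γ ++ p ∷ δ × B p × (∀ {c} → c ∈ γ → ¬ B c)
first-satisfying B? (x ∷ l) i Bb with B? x | i
... | yes Bx | _         = [] , x , l , refl , Bx , λ ()
... | no ¬Bx | here refl = contradiction Bb ¬Bx
... | no ¬Bx | there j with γ , p , δ , refl , Bp , none ← first-satisfying B? l j Bb =
  x ∷ γ , p , δ , refl , Bp , λ { (here refl) → ¬Bx ; (there k) → none k }

module LongestPath {n : ℕ} {L : Set} (Adj : Fin n → Fin n → Set) (x y : Fin n) (P : List (Fin n))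
  (uP : Unique P) (P-path : Path Adj x y P) (Adj-sym : ∀ {u v} → Adj u v → Adj v u)
  (longest : ∀ {Q} → Path Adj x y Q → Unique Q → length Q ≤ length P)
  (Out : Fin n → Set) (ℓ : Fin n → L)
  (bridge : ∀ {u v} → Out u → Out v → ℓ u ≡ ℓ v → ∃ λ κ → ∃ λ k → ∃ λ k′ →
    Path Adj k k′ κ × Adj u k × Adj k′ v × Unique κ × (∀ {w} → w ∈ κ → w ∉ P × ℓ w ≡ ℓ u))
  where

  -- Otherwise a detour inserted between `u` and `v` would lengthen P. This is what prevents green
  -- edges from running along P.
  Next-distinct-class : ∀ {u v} → Next P u v → Out u → Out v → ℓ u ≢ ℓ v
  Next-distinct-class {u} {v} i Ou Ov eq
    with l₁ , l₂ , refl ← Next-split i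
    with κ , k , k′ , q , a₁ , a₂ , uκ , cls ← bridge Ou Ov eq
    with q₁ , _ , q₂ ← Path-split-after l₁ P-path
    = ℕₚ.<⇒≱ (subst (length P <_) (sym (↭ₚ.↭-length perm)) P<κP)
        (longest (Path-++ q₁ a₁ (Path-++ q a₂ q₂)) (Unique-↭ (↭-sym perm) (Unique-++ uκ uP (λ i → proj₁ (cls i)))))
    where
    perm : (l₁ ++ [ u ]) ++ κ ++ v ∷ l₂ ↭ κ ++ l₁ ++ u ∷ v ∷ l₂
    perm = subst ((l₁ ++ [ u ]) ++ κ ++ v ∷ l₂ ↭_) (cong (κ ++_) (Listₚ.++-assoc l₁ [ u ] (v ∷ l₂)))
      (↭ₚ.shifts (l₁ ++ [ u ]) κ)
    P<κP : length (l₁ ++ u ∷ v ∷ l₂) < length (κ ++ l₁ ++ u ∷ v ∷ l₂)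
    P<κP with κ′ , refl ← Path-first q =
      s≤s (subst (_ ≤_) (sym (Listₚ.length-++ κ′)) (ℕₚ.m≤n+m _ _))

  Red-distinct-class : ∀ {u v} → Red P u v → Out u → Out v → ℓ u ≢ ℓ v
  Red-distinct-class (inj₁ i) Ou Ov e = Next-distinct-class i Ou Ov e
  Red-distinct-class (inj₂ i) Ou Ov e = Next-distinct-class i Ov Ou (sym e)

  module _ (g : Fin n → Fin n) (g-class : ∀ {v} → Out v → ℓ (g v) ≡ ℓ v) where

    -- `p` is the first centre. The prefix `α` is never rotated, so `closed` is demanded only from
    -- `p` on. The descent decreases `length β₀`.
    record Centres (A : Fin n → Set) (α : List (Fin n)) (p : Fin n) (β₀ : List (Fin n)) : Set where
      constructor centres
      field
        A?          : ∀ v → Dec (A v)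
        P≡          : P ≡ α ++ p ∷ β₀ ++ [ y ]
        α-free      : ∀ {a} → a ∈ α → ¬ A a
        A-p         : A p
        A-∈         : ∀ {a} → A a → a ∈ P
        A-Out       : ∀ {a} → A a → Out a
        A-injective : ∀ {a b} → A a → A b → ℓ a ≡ ℓ b → a ≡ b
        closed      : ∀ {u v} → Red (p ∷ β₀ ++ [ y ]) u v → A u → ¬ A v × Out v × A (g v)

    module Descend {A : Fin n → Set} {α p β₀} (C : Centres A α p β₀) where
      open Centres C

      β : List (Fin n)
      β = β₀ ++ [ y ]

      uαpβ : Unique (α ++ p ∷ β)
      uαpβ = subst Unique P≡ uP

      upβ : Unique (p ∷ β)
      upβ = Unique-++ʳ α uαpβ

      Red-P : ∀ {u v} → Red (p ∷ β) u v → Red P u v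
      Red-P i = subst (λ l → Red l _ _) (sym P≡) (Red-++ʳ α i)

      apart : ∀ {u v a} → Red (p ∷ β) a v → A a → Red (p ∷ β) u v → g v ≢ u
      apart i Aa j refl with _ , Ov , Ag ← closed i Aa =
        Red-distinct-class (Red-P j) (A-Out Ag) Ov (g-class Ov)

      A-∈pβ : ∀ {a} → A a → a ∈ p ∷ β
      A-∈pβ Aa with ∈ₚ.∈-++⁻ α (subst (_ ∈_) P≡ (A-∈ Aa))
      ... | inj₁ i = contradiction Aa (α-free i)
      ... | inj₂ i = i

      p-path : Path Adj p y (p ∷ β)
      p-path = Path-suffix α (subst (Path Adj x y) P≡ P-path)

      -- If `β` were `y` alone, the centre of `y` would be `p` or `y`. The first would give
      -- consecutive vertices of one class, and the second is excluded because `y` is next to the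
      -- centre `p`.
      open-path : ∀ {b₁ l} → Path Adj b₁ y l → l ≡ β → b₁ ≢ y
      open-path (e ▸ q) eq refl = Unique-head (subst Unique (sym eq) (Unique-tail upβ)) (Path-∈-last q)
      open-path stop eq _
        with ¬Ay , Oy , Ag ← closed {p} {y} (subst (λ l → Red (p ∷ l) p y) eq (inj₁ here)) A-p
        with subst (λ l → g y ∈ p ∷ l) (sym eq) (A-∈pβ Ag)
      ... | here e = Red-distinct-class (Red-P (subst (λ l → Red (p ∷ l) p y) eq (inj₁ here)))
                       (A-Out A-p) Oy (subst (λ v → ℓ v ≡ ℓ y) e (g-class Oy))
      ... | there (here e) = ¬Ay (subst A e Ag)

      module WithFirst {b₁ : Fin n} (β-adj : Path Adj b₁ y β) where

        open SecondPath A A? g p b₁ y β upβ (Path-map (λ i _ → inj₁ i) β-adj) (open-path β-adj refl)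
          A-p A-∈pβ (λ i Au → proj₁ (closed i Au) , proj₂ (proj₂ (closed i Au))) apart
          using (E; H; E-¬A; E-g; second-path)

        Green : Fin n → Fin n → Set
        Green u v = (E u × g u ≡ v) ⊎ (E v × g v ≡ u)

        Green-sym : ∀ {u v} → Green u v → Green v u
        Green-sym (inj₁ i) = inj₂ i
        Green-sym (inj₂ i) = inj₁ i

        E-Out : ∀ {v} → E v → Out v
        E-Out (_ , a , Aa , i) = proj₁ (proj₂ (closed i Aa))

        Red⇒¬Green : ∀ {u v} → Red (p ∷ β) u v → ¬ Green u v
        Red⇒¬Green i (inj₁ ((_ , a , Aa , j) , e)) = apart j Aa (Red-sym i) e
        Red⇒¬Green i (inj₂ ((_ , a , Aa , j) , e)) = apart j Aa i e

        Green-∈ : ∀ {u v} → Green u v → u ∈ p ∷ β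
        Green-∈ (inj₁ ((i , _) , _)) = there i
        Green-∈ (inj₂ (k , refl))    = A-∈pβ (E-g k)

        α-¬Green : ∀ {u v} → u ∈ α → ¬ Green u v
        α-¬Green i k = Unique-++-disjoint α uαpβ i (Green-∈ k)

        Green-ends : ∀ {u v} → Green u v → (A v × ¬ A u × Out u × ℓ u ≡ ℓ v) ⊎ (A u × ¬ A v × Out v × ℓ v ≡ ℓ u)
        Green-ends (inj₁ (k , refl)) = inj₁ (E-g k , E-¬A k , E-Out k , sym (g-class (E-Out k)))
        Green-ends (inj₂ (k , refl)) = inj₂ (E-g k , E-¬A k , E-Out k , sym (g-class (E-Out k)))

        open Lift Adj P Out ℓ bridge A A-injective A-Out Green Green-ends

        Red-Adj : ∀ {u v} → Red (p ∷ β) u v → Adj u v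
        Red-Adj (inj₁ i) = Path-Next p-path i
        Red-Adj (inj₂ i) = Adj-sym (Path-Next p-path i)

        H⇒Link : ∀ {u v} → H u v → Link u v
        H⇒Link (inj₁ i) = inj₁ (Red-Adj i , Red⇒¬Green i)
        H⇒Link (inj₂ k) = inj₂ k

        module Second {M} (M↭β : M ↭ β) (pM : Path H p y (p ∷ M)) (M≢β : M ≢ β) where

          W : List (Fin n)
          W = α ++ p ∷ M

          W↭P : W ↭ P
          W↭P = subst (W ↭_) (sym P≡) (↭ₚ.++⁺ˡ α (prep p M↭β))

          uW : Unique W
          uW = Unique-↭ (↭-sym W↭P) uP

          upM : Unique (p ∷ M)
          upM = Unique-++ʳ α uW

          W-path : Path Link x y W
          W-path = Path-replace α (subst (Path Adj x y) P≡ P-path) (λ i e → inj₁ (e , α-¬Green i))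
            (Path-map (λ _ → H⇒Link) pM)

          nonMixed : NonMixed false W
          nonMixed with lift (direct (λ _ → refl)) W-path uW (↭ₚ.∈-resp-↭ W↭P)
          ... | lifted path refl uQ _ (inj₁ lt) =
            contradiction (longest path uQ) (ℕₚ.<⇒≱ (subst (_< _) (↭ₚ.↭-length W↭P) lt))
          ... | lifted _ _ _ _ (inj₂ (_ , nm)) = nm

          B : Fin n → Set
          B a = A a × ∃ λ w → Red W a w × Green w a

          B-green : ∀ {a w} → B a → Red W a w → Green w a
          B-green (Aa , u , inj₁ i , k) (inj₁ j) with refl ← Next-functional uW i j = k
          B-green (Aa , u , inj₂ i , k) (inj₂ j) with refl ← Next-injective uW i j = k
          B-green (Aa , u , inj₁ i , k) (inj₂ j) = proj₂ (NonMixed-Next nonMixed j i Aa uW) (Green-sym k)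
          B-green (Aa , u , inj₂ i , k) (inj₁ j) = Green-sym (proj₁ (NonMixed-Next nonMixed i j Aa uW) k)

          -- The edge of `W` entering `p` comes from the unchanged prefix and is not green. If the
          -- prefix is empty, `p` has a single edge in `W`, and a green one would be mixed.
          first-¬B : ∀ α′ → α′ ≡ α → ¬ B p
          first-¬B [] refl (Aa , w , inj₁ i , k) = NonMixed-first nonMixed Aa i uW (Green-sym k)
          first-¬B [] refl (Aa , w , inj₂ i , k) = Next-not-first uW i
          first-¬B (u ∷ α′) refl Bp
            with w , i ← Next-pred {w = u} (∈ₚ.∈-++⁺ʳ α′ {ys = [ p ]} (here refl))
            with j ← Next-++ˡ {r = M} i
            = α-¬Green (go α′ i) (B-green Bp (inj₂ (subst (λ l → Next l w p) (cong (u ∷_) (Listₚ.++-assoc α′ [ p ] M)) j)))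
            where
            go : ∀ {u w} l → Next (u ∷ l ++ [ p ]) w p → w ∈ u ∷ l
            go []      here         = here refl
            go []      (there (there ()))
            go (z ∷ l) here         = here refl
            go (z ∷ l) (there i)    = there (go l i)

          last-¬B : ¬ B y
          last-¬B (Ay , w , inj₁ i , k) = Path-no-succ uW W-path i
          last-¬B (Ay , w , inj₂ i , k) = NonMixed-last uW nonMixed Ay W-path i k

          Green⇒B : ∀ {v w} → ¬ A v → Red W v w → Green v w → B (g v)
          Green⇒B ¬Av i (inj₁ (k , refl)) = E-g k , _ , Red-sym i , inj₁ (k , refl)
          Green⇒B ¬Av i (inj₂ (k , refl)) = contradiction (E-g k) ¬Av

          -- All edges of `W` at `u` are green, so `v` has lost its red edge to `u`. It has as many
          -- edges in `W` as along P, hence `W` uses the green edge at `v`, and the centre of `v`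
          -- belongs to `B`.
          B-closed : ∀ {u v} → Red (p ∷ β) u v → B u → ¬ B v × Out v × B (g v)
          B-closed {u} {v} i Bu@(Au , _) with ¬Av , Ov , Ag ← closed i Au =
            ¬Av ∘ proj₁ , Ov , go (Red-∈ʳ i)
            where
            ¬Red : ¬ Red W u v
            ¬Red j = Red⇒¬Green i (Green-sym (B-green Bu j))
            go : v ∈ p ∷ β → B (g v)
            go (here refl) = contradiction A-p ¬Av
            go (there v∈β)
              with v∈M ← ↭ₚ.∈-resp-↭ (↭-sym M↭β) v∈β
              with w₁ , j₁ ← Next-pred {w = p} v∈M
              with Path-Next pM j₁
            ... | inj₂ k = Green⇒B ¬Av (Red-++ʳ α (inj₂ j₁)) (Green-sym k)
            ... | inj₁ r₁ with v Finₚ.≟ y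
            -- `y` has one edge in `W` and one in `p ∷ β`; if the former were red, it would be the
            -- lost edge to `u`.
            ...   | yes refl = ⊥-elim (¬Red (inj₁ (subst (λ w → Next W w v) (only-pred r₁ i) (Next-++ʳ α j₁))))
              where
              only-pred : ∀ {w w′} → Red (p ∷ β) w y → Red (p ∷ β) w′ y → w ≡ w′
              only-pred (inj₁ a) (inj₁ b) = Next-injective upβ a b
              only-pred (inj₂ a) _        = ⊥-elim (Path-no-succ upβ p-path a)
              only-pred _        (inj₂ b) = ⊥-elim (Path-no-succ upβ p-path b)
            ...   | no v≢y
              with w₂ , j₂ ← Path-succ pM (there v∈M) v≢y
              with Path-Next pM j₂
            ...     | inj₂ k = Green⇒B ¬Av (Red-++ʳ α (inj₁ j₂)) k
            ...     | inj₁ r₂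
              with Red-third upβ (λ { refl → Next-asym upM j₁ j₂ }) (Red-sym r₁) r₂ (Red-sym i)
            ...       | inj₁ refl = ⊥-elim (¬Red (Red-++ʳ α (inj₁ j₁)))
            ...       | inj₂ refl = ⊥-elim (¬Red (Red-++ʳ α (inj₂ j₂)))

          B-nonempty : ¬ (∀ a → ¬ B a)
          B-nonempty none = M≢β (Red-rigid M upβ upM M↭β λ i → red i (Path-Next pM i))
            where
            red : ∀ {u v} → Next (p ∷ M) u v → H u v → Red (p ∷ β) u v
            red i (inj₁ r) = r
            red i (inj₂ (inj₁ (k , refl))) = ⊥-elim (none _ (E-g k , _ , Red-++ʳ α (inj₂ i) , inj₁ (k , refl)))
            red i (inj₂ (inj₂ (k , refl))) = ⊥-elim (none _ (E-g k , _ , Red-++ʳ α (inj₁ i) , inj₁ (k , refl)))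

          B-∈β₀ : ∀ {b} → B b → b ∈ p ∷ β → b ∈ β₀
          B-∈β₀ Bb (here refl) = ⊥-elim (first-¬B α refl Bb)
          B-∈β₀ Bb (there i) with ∈ₚ.∈-++⁻ β₀ i
          ... | inj₁ j           = j
          ... | inj₂ (here refl) = ⊥-elim (last-¬B Bb)

          smaller : (∀ v → Dec (B v)) →
            ∃ λ α′ → ∃ λ p′ → ∃ λ δ → length δ < length β₀ × Centres B α′ p′ δ
          smaller B? with Finₚ.any? B?
          ... | no none = ⊥-elim (B-nonempty (λ a Ba → none (a , Ba)))
          ... | yes (b , Bb)
            with γ , p′ , δ , refl , Bp′ , γ-free ← first-satisfying B? β₀ (B-∈β₀ Bb (A-∈pβ (proj₁ Bb))) Bb
            = α ++ p ∷ γ , p′ , δ , shorter γ ,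
              centres B? (trans P≡ assoc) (λ i → free (∈ₚ.∈-++⁻ α i)) Bp′ (A-∈ ∘ proj₁) (A-Out ∘ proj₁)
                (λ Ba Bb → A-injective (proj₁ Ba) (proj₁ Bb))
                (λ i → B-closed (subst (λ l → Red (p ∷ l) _ _) (sym (Listₚ.++-assoc γ (p′ ∷ δ) [ y ])) (Red-++ʳ (p ∷ γ) i)))
            where
            assoc : α ++ p ∷ (γ ++ p′ ∷ δ) ++ [ y ] ≡ (α ++ p ∷ γ) ++ p′ ∷ δ ++ [ y ]
            assoc = trans (cong (λ l → α ++ p ∷ l) (Listₚ.++-assoc γ (p′ ∷ δ) [ y ]))
              (sym (Listₚ.++-assoc α (p ∷ γ) (p′ ∷ δ ++ [ y ])))
            shorter : ∀ γ → length δ < length (γ ++ p′ ∷ δ)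
            shorter []      = ℕₚ.≤-refl
            shorter (_ ∷ γ) = ℕₚ.m≤n⇒m≤1+n (shorter γ)
            free : ∀ {a} → a ∈ α ⊎ a ∈ p ∷ γ → ¬ B a
            free (inj₁ i)           = α-free i ∘ proj₁
            free (inj₂ (here refl)) = first-¬B α refl
            free (inj₂ (there i))   = γ-free i

        descend : (∀ {B α′ p′ δ} → length δ < length β₀ → ¬ Centres B α′ p′ δ) → ⊥
        descend rec = second-path only
          where
          only : ∀ {M} → M ↭ β → Path H p y (p ∷ M) → M ≡ β
          only {M} M↭β pM with Listₚ.≡-dec Finₚ._≟_ M β
          ... | yes e = e
          ... | no M≢β = ⊥-elim (¬¬-Fin (λ _ → ¬¬-excluded-middle) λ B? →
            case Second.smaller M↭β pM M≢β B? of λ { (_ , _ , _ , lt , C′) → rec lt C′ })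

    no-centres : ∀ k {A α p β₀} → length β₀ < k → ¬ Centres A α p β₀
    no-centres (suc k) {β₀ = β₀} (s≤s le) C = go (Descend.p-path C) refl
      where
      go : ∀ {p l} → Path Adj p y (p ∷ l) → l ≡ Descend.β C → ⊥
      go stop    eq = case trans (cong length eq) (Listₚ.length-++ β₀) of λ e →
        contradiction (trans e (ℕₚ.+-comm (length β₀) 1)) λ ()
      go (_ ▸ q) refl = Descend.WithFirst.descend C q (λ lt → no-centres k (ℕₚ.<-≤-trans lt le))

  -- `Out y` guarantees a centre, and the first one on P starts the descent. `near-centre` can make
  -- an exception for `x`, because from the first centre `p` on `x` can occur only as `p` itself.
  no-transversal : x ≢ y → ¬ Next P x y → (∀ {v} → Out v → v ∈ P) →
    (g : Fin n → Fin n) (g-class : ∀ {v} → Out v → ℓ (g v) ≡ ℓ v)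
    {A : Fin n → Set} (A? : ∀ v → Dec (A v)) (A-Out : ∀ {a} → A a → Out a) (A-g : ∀ {v} → Out v → A (g v))
    (A-injective : ∀ {a b} → A a → A b → ℓ a ≡ ℓ b → a ≡ b)
    (A-independent : ∀ {u v} → Red P u v → A u → A v → ⊥)
    (near-centre : ∀ {u v} → Red P u v → A u → v ≢ x → Out v) →
    ¬ Out y
  no-transversal x≢y x≁y Out-∈ g g-class {A} A? A-Out A-g A-injective A-independent near-centre y-Out
    with α , p , δ , P≡ , Ap , α-free ← first-satisfying A? P (Out-∈ (A-Out (A-g y-Out))) (A-g y-Out)
    = go α-free Ap P≡ (Path-suffix α (subst (Path Adj x y) P≡ P-path))
    where
    go : ∀ {α p δ} → (∀ {a} → a ∈ α → ¬ A a) → A p → P ≡ α ++ p ∷ δ → Path Adj p y (p ∷ δ) → ⊥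
    -- If the first centre is `y`, it is also the centre of its predecessor, and two consecutive
    -- vertices share a class.
    go {α} α-free Ap P≡ stop
      with r , i ← Path-pred P-path (Out-∈ y-Out) (x≢y ∘ sym)
      with Or ← near-centre (inj₂ i) Ap (λ { refl → x≁y i })
      with ∈ₚ.∈-++⁻ α (subst (g r ∈_) P≡ (Out-∈ (A-Out (A-g Or))))
    ... | inj₁ j        = α-free j (A-g Or)
    ... | inj₂ (here e) = Next-distinct-class i Or y-Out (trans (sym (g-class Or)) (cong ℓ e))
    go {α} {p} α-free Ap P≡ (_ ▸ q)
      with β₀ , refl ← Path-last q
      = no-centres g g-class (suc (length β₀)) ℕₚ.≤-refl
          (centres A? P≡ α-free Ap (Out-∈ ∘ A-Out) A-Out A-injective closed)
      where
      Red-P : ∀ {u v} → Red (p ∷ β₀ ++ [ y ]) u v → Red P u v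
      Red-P i = subst (λ l → Red l _ _) (sym P≡) (Red-++ʳ α i)
      first : ∀ {l} → Path Adj x y (l ++ p ∷ β₀ ++ [ y ]) → Unique (l ++ p ∷ β₀ ++ [ y ]) →
        x ∈ p ∷ β₀ ++ [ y ] → x ≡ p
      first {[]}    q _ _ = Path-head q
      first {u ∷ l} q un i with refl ← Path-head q = contradiction (∈ₚ.∈-++⁺ʳ l i) (Unique-head un)
      closed : ∀ {u v} → Red (p ∷ β₀ ++ [ y ]) u v → A u → ¬ A v × Out v × A (g v)
      closed {u} {v} i Au = ¬Av , Ov , A-g Ov
        where
        ¬Av : ¬ A v
        ¬Av = A-independent (Red-P i) Au
        Ov = near-centre (Red-P i) Au λ { refl → ¬Av (subst A
          (sym (first (subst (Path Adj x y) P≡ P-path) (subst Unique P≡ uP) (Red-∈ʳ i))) Ap) }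

-- Longest paths in cubic 3-connected graphs

count-vmap : ∀ {A : Set} (f : A → Bool) P → count (vmap f P) ≡ length (filter (λ v → f v Boolₚ.≟ true) P)
count-vmap f []      = refl
count-vmap f (v ∷ P) with f v
... | true  = cong suc (count-vmap f P)
... | false = count-vmap f P

does-true : {A : Set} (d : Dec A) → does d ≡ true → A
does-true (yes a) _ = a

module _ {A : Set} where

  find : {Q : A → Set} → (∀ v → Dec (Q v)) → A → List A → A
  find Q? d []       = d
  find Q? d (v ∷ vs) with Q? v
  ... | yes _ = v
  ... | no  _ = find Q? d vs

  find-sound : ∀ {Q : A → Set} (Q? : ∀ v → Dec (Q v)) d {v} vs → v ∈ vs → Q v → Q (find Q? d vs)
  find-sound Q? d (w ∷ vs) i q with Q? w | i
  ... | yes r | _         = r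
  ... | no ¬r | here refl = contradiction q ¬r
  ... | no ¬r | there j   = find-sound Q? d vs j q

  find-cong : ∀ {Q Q′ : A → Set} (Q? : ∀ v → Dec (Q v)) (Q′? : ∀ v → Dec (Q′ v)) d d′ {v} vs → v ∈ vs → Q v →
    (∀ {w} → Q w → Q′ w) → (∀ {w} → Q′ w → Q w) → find Q? d vs ≡ find Q′? d′ vs
  find-cong Q? Q′? d d′ (w ∷ vs) i q f f′ with Q? w | Q′? w | i
  ... | yes _ | yes _  | _         = refl
  ... | yes r | no ¬r′ | _         = contradiction (f r) ¬r′
  ... | no ¬r | yes r′ | _         = contradiction (f′ r′) ¬r
  ... | no ¬r | no _   | here refl = contradiction q ¬r
  ... | no _  | no _   | there j   = find-cong Q? Q′? d d′ vs j q f f′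

module InGraph {n : ℕ} (G : Graph n) (cubic : Cubic G) where

  open DecMembership (Finₚ._≟_ {n}) public using (_∈?_)

  Adj-sym : ∀ {u v} → Adj G u v → Adj G v u
  Adj-sym {u} {v} e = trans (symm G v u) e

  Adj-irrefl : ∀ {v} → ¬ Adj G v v
  Adj-irrefl {v} e with () ← trans (sym e) (irrefl G v)

  Adj-∉ : ∀ {u v} → Adj G u v → v ∉ [ u ]
  Adj-∉ e (here refl) = Adj-irrefl e

  Adj? : ∀ u v → Dec (Adj G u v)
  Adj? u v = adj G u v Boolₚ.≟ true

  neighbourhood : Fin n → List (Fin n)
  neighbourhood v = filter (Adj? v) (allFin n)

  degree-length : ∀ v → length (neighbourhood v) ≡ 3
  degree-length v = trans (sym (go (allFin n))) (cubic v)
    where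
    go : ∀ us → sum (map (λ u → if adj G v u then 1 else 0) us) ≡ length (filter (Adj? v) us)
    go []       = refl
    go (u ∷ us) with adj G v u
    ... | true  = cong suc (go us)
    ... | false = go us

  at-most-three : ∀ {v a b c d} → Adj G v a → Adj G v b → Adj G v c → Adj G v d →
    a ≢ b → a ≢ c → a ≢ d → b ≢ c → b ≢ d → c ≢ d → ⊥
  at-most-three {v} {a} {b} {c} {d} va vb vc vd ab ac ad bc bd cd =
    ℕₚ.1+n≰n (subst (4 ≤_) (degree-length v) (Unique-⊆-length {l = a ∷ b ∷ c ∷ d ∷ []}
      ((ab ∷ ac ∷ ad ∷ []) ∷ (bc ∷ bd ∷ []) ∷ (cd ∷ []) ∷ [] ∷ [])
      (λ { (here refl) → mem va ; (there (here refl)) → mem vb ; (there (there (here refl))) → mem vc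
         ; (there (there (there (here refl)))) → mem vd })))
    where
    mem : ∀ {w} → Adj G v w → w ∈ neighbourhood v
    mem {w} e = ∈ₚ.∈-filter⁺ (Adj? v) (∈ₚ.∈-allFin w) e

  third-neighbour : ∀ v a b → ∃ λ t → Adj G v t × t ≢ a × t ≢ b
  third-neighbour v a b
    with Finₚ.any? (λ t → Adj? v t ×-dec (¬? (t Finₚ.≟ a) ×-dec ¬? (t Finₚ.≟ b)))
  ... | yes r = r
  ... | no none = ⊥-elim (ℕₚ.1+n≰n (subst (_≤ 2) (degree-length v)
          (Unique-⊆-length {r = a ∷ b ∷ []} (Uniqueₚ.filter⁺ (Adj? v) (Uniqueₚ.allFin⁺ n)) (λ i → sub (proj₂ (∈ₚ.∈-filter⁻ (Adj? v) {xs = allFin n} i))))))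
    where
    sub : ∀ {w} → Adj G v w → w ∈ a ∷ b ∷ []
    sub {w} e with w Finₚ.≟ a | w Finₚ.≟ b
    ... | yes refl | _        = here refl
    ... | no _     | yes refl = there (here refl)
    ... | no wa    | no wb    = contradiction (w , e , wa , wb) none

  module _ {S : List (Fin n)} where

    private
      _⇝_ : Fin n → Fin n → Set
      _⇝_ = WalkAvoiding G S

    walk-trans : ∀ {a b c} → a ⇝ b → b ⇝ c → a ⇝ c
    walk-trans here           w′ = w′
    walk-trans (step e b∉ w) w′ = step e b∉ (walk-trans w w′)

    walk-sym : ∀ {a b} → a ∉ S → a ⇝ b → b ⇝ a
    walk-sym a∉ here          = here
    walk-sym a∉ (step e b∉ w) = walk-trans (walk-sym b∉ w) (step (Adj-sym e) a∉ here)

    walk-end : ∀ {a b} → a ∉ S → a ⇝ b → b ∉ S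
    walk-end a∉ here          = a∉
    walk-end a∉ (step e b∉ w) = walk-end b∉ w

    loop-erasure : ∀ {a b} → a ∉ S → a ⇝ b → ∃ λ l → Path (Adj G) a b l × Unique l × (∀ {w} → w ∈ l → a ⇝ w)
    loop-erasure {a} a∉ here = [ a ] , stop , [] ∷ [] , λ { (here refl) → here }
    loop-erasure {a} a∉ (step e b∉ w) with l , q , ul , h ← loop-erasure b∉ w with a ∈? l
    ... | no a∉l = a ∷ l , e ▸ q , Unique-cons a∉l ul , λ { (here refl) → here ; (there i) → step e b∉ (h i) }
    ... | yes a∈l with l₁ , l₂ , refl ← ∈ₚ.∈-∃++ a∈l =
      a ∷ l₂ , Path-suffix l₁ q , Unique-++ʳ l₁ ul , λ i → step e b∉ (h (∈ₚ.∈-++⁺ʳ l₁ i))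

  record Longest (x y : Fin n) (P : List (Fin n)) : Set where
    field
      path    : Path (Adj G) x y P
      unique  : Unique P
      longest : ∀ {Q} → Path (Adj G) x y Q → Unique Q → length Q ≤ length P

  Longest-reverse : ∀ {x y P} → Longest x y P → Longest y x (reverse P)
  Longest-reverse {P = P} long = record
    { path    = Path-reverse Adj-sym path
    ; unique  = Unique-↭ (↭-sym (↭ₚ.↭-reverse P)) unique
    ; longest = λ {Q} q uQ → subst₂ _≤_ (Listₚ.length-reverse Q) (sym (Listₚ.length-reverse P))
        (longest (Path-reverse Adj-sym q) (Unique-↭ (↭-sym (↭ₚ.↭-reverse Q)) uQ)) }
    where open Longest long

  module LongPath (conn : KConnected 3 G) {x y : Fin n} (x≢y : x ≢ y) (xy : Adj G x y) {P : List (Fin n)}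
    (long : Longest x y P) where

    open Longest long

    Next-ends : Next P x y → length P ≡ 2
    Next-ends i = go path unique i
      where
      go : ∀ {l} → Path (Adj G) x y l → Unique l → Next l x y → length l ≡ 2
      go (_ ▸ stop)    ul here      = refl
      go (_ ▸ (_ ▸ q)) ul here      = ⊥-elim (Unique-head (Unique-tail ul) (Path-∈-last q))
      go (_ ▸ q)       ul (there i) = ⊥-elim (Unique-head ul (Next-∈ˡ i))

    -- `G` without `x` is connected, so another neighbour of `x` leads to `y`; the resulting path is
    -- longer than the edge `xy`.
    length≢2 : length P ≢ 2
    length≢2 e
      with u , xu , u≢y , _ ← third-neighbour x y y
      with u∉ ← Adj-∉ xu
      with l , q , ul , h ← loop-erasure u∉ (proj₂ conn [ x ] (s≤s (s≤s z≤n)) u y u∉ (λ { (here refl) → x≢y refl }))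
      = ℕₚ.<⇒≱ (two u≢y q)
          (ℕₚ.≤-pred (subst (suc (length l) ≤_) e
            (longest (xu ▸ q) (Unique-cons (λ i → walk-end u∉ (h i) (here refl)) ul))))
      where
      two : ∀ {u v l} → u ≢ v → Path (Adj G) u v l → 1 < length l
      two n stop                = contradiction refl n
      two n (_ ▸ stop)          = s≤s (s≤s z≤n)
      two n (_ ▸ (_ ▸ _))       = s≤s (s≤s z≤n)

    3≤length : 3 ≤ length P
    3≤length = ℕₚ.≤∧≢⇒< (go path) (length≢2 ∘ sym)
      where
      go : ∀ {l} → Path (Adj G) x y l → 2 ≤ length l
      go stop       = contradiction refl x≢y
      go (_ ▸ q) with _ , refl ← Path-first q = s≤s (s≤s z≤n)

    Red-Adj : ∀ {u v} → Red P u v → Adj G u v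
    Red-Adj (inj₁ i) = Path-Next path i
    Red-Adj (inj₂ i) = Adj-sym (Path-Next path i)

    -- At an end of P the edge `xy` replaces the missing neighbour along P; here the adjacency of
    -- the ends enters.
    two-inside : ∀ {v} → v ∈ P → ∃ λ a → ∃ λ b → a ≢ b × a ∈ P × b ∈ P × Adj G v a × Adj G v b
    two-inside {v} v∈ with v Finₚ.≟ x | v Finₚ.≟ y
    ... | yes refl | _ with s , i ← Path-succ path v∈ x≢y =
      s , y , (λ { refl → length≢2 (Next-ends i) }) , Next-∈ʳ i , Path-∈-last path , Red-Adj (inj₁ i) , xy
    ... | no v≢x | yes refl with r , i ← Path-pred path v∈ v≢x =
      r , x , (λ { refl → length≢2 (Next-ends i) }) , Next-∈ˡ i , Path-∈-first path , Red-Adj (inj₂ i) , Adj-sym xy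
    ... | no v≢x | no v≢y with r , i ← Path-pred path v∈ v≢x | s , j ← Path-succ path v∈ v≢y =
      r , s , (λ { refl → Next-asym unique i j }) , Next-∈ˡ i , Next-∈ʳ j , Red-Adj (inj₂ i) , Red-Adj (inj₁ j)

    outside-unique : ∀ {v u w} → v ∈ P → Adj G v u → u ∉ P → Adj G v w → w ∉ P → u ≡ w
    outside-unique {v} {u} {w} v∈ vu u∉ vw w∉ with u Finₚ.≟ w
    ... | yes e = e
    ... | no u≢w with a , b , a≢b , a∈ , b∈ , va , vb ← two-inside v∈ =
      ⊥-elim (at-most-three vu vw va vb u≢w (λ { refl → u∉ a∈ }) (λ { refl → u∉ b∈ })
        (λ { refl → w∉ a∈ }) (λ { refl → w∉ b∈ }) a≢b)

    Out : Fin n → Set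
    Out v = v ∈ P × ∃ λ u → u ∉ P × Adj G v u

    Out? : ∀ v → Dec (Out v)
    Out? v = (v ∈? P) ×-dec Finₚ.any? (λ u → ¬? (u ∈? P) ×-dec Adj? v u)

    Internal : Fin n → Set
    Internal v = v ∈ P × v ≢ x × v ≢ y

    ¬Out⇒Bound : ∀ {v} → v ∈ P → ¬ Out v → Bound G P v
    ¬Out⇒Bound {v} v∈ ¬Ov u vu with u ∈? P
    ... | yes u∈ = u∈
    ... | no u∉  = contradiction (v∈ , u , u∉ , vu) ¬Ov

    chord-Bound : ∀ {v t} → Internal v → Adj G v t → t ∈ P → ¬ Red P t v → Bound G P v
    chord-Bound {v} {t} (v∈ , v≢x , v≢y) vt t∈ chord
      with r , i ← Path-pred path v∈ v≢x | s , j ← Path-succ path v∈ v≢y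
      = ¬Out⇒Bound v∈ λ { (_ , u , u∉ , vu) →
          at-most-three vu vt (Red-Adj (inj₂ i)) (Red-Adj (inj₁ j))
            (λ { refl → u∉ t∈ }) (λ { refl → u∉ (Next-∈ˡ i) }) (λ { refl → u∉ (Next-∈ʳ j) })
            (λ { refl → chord (inj₁ i) }) (λ { refl → chord (inj₂ j) }) (λ { refl → Next-asym unique i j }) }

    -- Components outside the path and their attachments

    module Classes (walk? : ∀ u w → Dec (WalkAvoiding G P u w)) where

      rep : Fin n → Fin n
      rep u = find (walk? u) u (allFin n)

      rep-walk : ∀ u → WalkAvoiding G P u (rep u)
      rep-walk u = find-sound (walk? u) u (allFin n) (∈ₚ.∈-allFin u) here

      rep-cong : ∀ {u w} → u ∉ P → WalkAvoiding G P u w → rep u ≡ rep w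
      rep-cong {u} {w} u∉ uw = find-cong (walk? u) (walk? w) u w (allFin n) (∈ₚ.∈-allFin u) here
        (walk-trans (walk-sym u∉ uw)) (walk-trans uw)

      rep-injective : ∀ {u w} → w ∉ P → rep u ≡ rep w → WalkAvoiding G P u w
      rep-injective {u} {w} w∉ e = walk-trans (rep-walk u)
        (subst (λ r → WalkAvoiding G P r w) (sym e) (walk-sym w∉ (rep-walk w)))

      outside : Fin n → Fin n
      outside v with Out? v
      ... | yes (_ , u , _) = u
      ... | no _            = v

      outside-spec : ∀ {v} → Out v → outside v ∉ P × Adj G v (outside v)
      outside-spec {v} Ov with Out? v
      ... | yes (_ , u , s) = s
      ... | no ¬Ov          = contradiction Ov ¬Ov

      -- One labelling for both sides: an attached vertex of P gets the component of its unique
      -- outside neighbour, so a detour and its two ends carry the same label.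
      ℓ : Fin n → Fin n
      ℓ v = if does (v ∈? P) then rep (outside v) else rep v

      ℓ-inside : ∀ {v} → v ∈ P → ℓ v ≡ rep (outside v)
      ℓ-inside {v} i = cong (if_then rep (outside v) else rep v) (dec-true (v ∈? P) i)

      ℓ-outside : ∀ {v} → v ∉ P → ℓ v ≡ rep v
      ℓ-outside {v} n = cong (if_then rep (outside v) else rep v) (dec-false (v ∈? P) n)

      ℓ-Out : ∀ {v u} → v ∈ P → Adj G v u → u ∉ P → ℓ v ≡ rep u
      ℓ-Out {v} {u} v∈ vu u∉ with o∉ , vo ← outside-spec (v∈ , u , u∉ , vu) =
        trans (ℓ-inside v∈) (cong rep (outside-unique v∈ vo o∉ vu u∉))

      bridge : ∀ {u v} → Out u → Out v → ℓ u ≡ ℓ v → ∃ λ κ → ∃ λ k → ∃ λ k′ →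
        Path (Adj G) k k′ κ × Adj G u k × Adj G k′ v × Unique κ × (∀ {w} → w ∈ κ → w ∉ P × ℓ w ≡ ℓ u)
      bridge {u} {v} (u∈ , k , k∉ , uk) (v∈ , k′ , k′∉ , vk′) eq
        with κ , q , uκ , h ← loop-erasure k∉ (rep-injective k′∉
               (trans (sym (ℓ-Out u∈ uk k∉)) (trans eq (ℓ-Out v∈ vk′ k′∉))))
        = κ , k , k′ , q , uk , Adj-sym vk′ , uκ , λ i →
          walk-end k∉ (h i) , trans (ℓ-outside (walk-end k∉ (h i))) (trans (sym (rep-cong k∉ (h i))) (sym (ℓ-Out u∈ uk k∉)))

      open LongestPath (Adj G) x y P unique path Adj-sym longest Out ℓ bridge

      Attached : Fin n → Fin n → Set
      Attached j v = Out v × ℓ v ≡ j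

      Attached? : ∀ j v → Dec (Attached j v)
      Attached? j v = Out? v ×-dec (ℓ v Finₚ.≟ j)

      attachments : Fin n → List (Fin n)
      attachments j = filter (Attached? j) P

      no-escape : ∀ {j a b} → a ∉ P → rep a ≡ j → b ∈ P → ¬ WalkAvoiding G (attachments j) a b
      no-escape a∉ e b∈ here = a∉ b∈
      no-escape {a = a} a∉ refl b∈ (step {b = c} ac c∉ w) with c ∈? P
      ... | yes c∈ = c∉ (∈ₚ.∈-filter⁺ (Attached? _) c∈ ((c∈ , a , a∉ , Adj-sym ac) , ℓ-Out c∈ (Adj-sym ac) a∉))
      ... | no c∉P = no-escape c∉P (sym (rep-cong a∉ (step ac c∉P here))) b∈ w

      -- Fewer than three attachments would separate the component from the rest of P. There is a
      -- rest, because P has at least three vertices.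
      three-attachments : ∀ {v} → Out v → 3 ≤ length (attachments (ℓ v))
      three-attachments {v} (v∈ , u , u∉ , vu) with 3 ℕₚ.≤? length (attachments (ℓ v))
      ... | yes le = le
      ... | no nle with Finₚ.any? (λ b → (b ∈? P) ×-dec ¬? (b ∈? attachments (ℓ v)))
      ...   | yes (b , b∈ , b∉) = ⊥-elim (no-escape u∉ (sym (ℓ-Out v∈ vu u∉)) b∈
                (proj₂ conn _ (ℕₚ.≰⇒> nle) u b (λ i → u∉ (proj₁ (∈ₚ.∈-filter⁻ (Attached? _) i))) b∉))
      ...   | no none = ⊥-elim (nle (ℕₚ.≤-trans 3≤length (Unique-⊆-length unique sub)))
        where
        sub : ∀ {b} → b ∈ P → b ∈ attachments (ℓ v)
        sub {b} b∈ with b ∈? attachments (ℓ v)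
        ... | yes i = i
        ... | no ni = contradiction (b , b∈ , ni) none

      -- Choice of the centres

      module Avoiding (av : List (Fin n)) (av≤2 : length av ≤ 2) (y-Out : Out y)
        (inner : ∀ {u v} → v ∈ P → v ≢ x → ¬ Out v → Red P u v → u ∈ av) where

        Usable : Fin n → Fin n → Set
        Usable j v = Attached j v × v ∉ av

        Usable? : ∀ j v → Dec (Usable j v)
        Usable? j v = Attached? j v ×-dec ¬? (v ∈? av)

        τ : Fin n → Fin n → Bool
        τ j v = does (Usable? j v)

        τ⇒ : ∀ {j} v → τ j v ≡ true → Usable j v
        τ⇒ {j} v e = does-true (Usable? j v) e

        ⇒τ : ∀ {j v} → Usable j v → τ j v ≡ true
        ⇒τ {j} {v} u = dec-true (Usable? j v) u

        open Transversal P τ (λ v e e′ → trans (sym (proj₂ (proj₁ (τ⇒ v e)))) (proj₂ (proj₁ (τ⇒ v e′))))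

        labels : List (Fin n)
        labels = deduplicate Finₚ._≟_ (map ℓ (filter Out? P))

        ℓ-∈-labels : ∀ {v} → Out v → ℓ v ∈ labels
        ℓ-∈-labels Ov = ∈ₚ.∈-deduplicate⁺ Finₚ._≟_ (∈ₚ.∈-map⁺ ℓ (∈ₚ.∈-filter⁺ Out? (proj₁ Ov) Ov))

        Class : Fin n → Set
        Class j = ∃ λ v → Out v × j ≡ ℓ v

        labels-Class : All Class labels
        labels-Class = All.tabulate λ i →
          let v , v∈ , e = ∈ₚ.∈-map⁻ ℓ (∈ₚ.∈-deduplicate⁻ Finₚ._≟_ _ i)
          in v , proj₂ (∈ₚ.∈-filter⁻ Out? {xs = P} v∈) , e

        all-attachments : ∀ K → Unique K → All Class K → ∃ λ X → Unique X × 3 * length K ≤ length X ×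
          (∀ {v} → v ∈ X → Out v × ℓ v ∈ K)
        all-attachments [] _ _ = [] , [] , z≤n , λ ()
        all-attachments (k ∷ K) uK ((w , Ow , refl) ∷ cs)
          with X , uX , le , h ← all-attachments K (Unique-tail uK) cs
          = attachments k ++ X ,
            Unique-++ (Uniqueₚ.filter⁺ (Attached? k) unique) uX
              (λ i j → Unique-head uK (subst (_∈ K) (proj₂ (att i)) (proj₂ (h j)))) ,
            subst₂ _≤_ (sym (ℕₚ.*-suc 3 (length K))) (sym (Listₚ.length-++ (attachments k)))
              (ℕₚ.+-mono-≤ (three-attachments Ow) le) ,
            λ i → [ (λ j → proj₁ (att j) , here (proj₂ (att j))) , (λ j → proj₁ (h j) , there (proj₂ (h j))) ]′
                    (∈ₚ.∈-++⁻ (attachments k) i)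
          where
          att : ∀ {v} → v ∈ attachments (ℓ w) → Attached (ℓ w) v
          att i = proj₂ (∈ₚ.∈-filter⁻ (Attached? (ℓ w)) {xs = P} i)

        -- The attachments of all classes in `K` are counted together, so the at most two forbidden
        -- vertices are subtracted once and not for every class.
        hall : ∀ K → Unique K → All Class K → 3 * length K ≤ 2 + count (W K)
        hall K uK cs with X , uX , le , h ← all-attachments K uK cs =
          ℕₚ.≤-trans le (ℕₚ.≤-trans (Unique-⊆-length uX sub)
            (subst (_≤ 2 + count (W K)) (sym (Listₚ.length-++ av))
              (ℕₚ.+-mono-≤ av≤2 (ℕₚ.≤-reflexive (sym (count-vmap (ω K) P))))))
          where
          sub : ∀ {v} → v ∈ X → v ∈ av ++ filter (λ w → ω K w Boolₚ.≟ true) P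
          sub {v} i with v ∈? av
          ... | yes j = ∈ₚ.∈-++⁺ˡ j
          ... | no v∉ = ∈ₚ.∈-++⁺ʳ av (∈ₚ.∈-filter⁺ (λ w → ω K w Boolₚ.≟ true) (proj₁ (proj₁ (h i)))
                          (ω-∋ uK (proj₂ (h i)) (⇒τ ((proj₁ (h i) , refl) , v∉))))

        uniqueLabels : Unique labels
        uniqueLabels = UniqueDecₚ.deduplicate-! Finₚ._≟_ _

        module _ (T : Fin n → Set) (meets : ∀ {j} → j ∈ labels → ∃ λ v → v ∈ P × T v × τ j v ≡ true)
          (independent : ∀ {u v} → Next P u v → T u → T v → ⊥) where

          centre : Fin n → Fin n
          centre j with j ∈? labels
          ... | yes i = proj₁ (meets i)
          ... | no _  = j

          centre-spec : ∀ {j} → j ∈ labels → T (centre j) × Usable j (centre j)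
          centre-spec {j} i with j ∈? labels
          ... | no n = contradiction i n
          ... | yes k with v , _ , t , e ← meets k = t , τ⇒ v e

          g : Fin n → Fin n
          g v = centre (ℓ v)

          g-class : ∀ {v} → Out v → ℓ (g v) ≡ ℓ v
          g-class Ov = proj₂ (proj₁ (proj₂ (centre-spec (ℓ-∈-labels Ov))))

          -- Cut out by `g` instead of `T`: this makes the set decidable and gives one member per
          -- class at once.
          A : Fin n → Set
          A a = Out a × g a ≡ a

          A? : ∀ a → Dec (A a)
          A? a = Out? a ×-dec (g a Finₚ.≟ a)

          A-g : ∀ {v} → Out v → A (g v)
          A-g Ov = proj₁ (proj₁ (proj₂ (centre-spec (ℓ-∈-labels Ov)))) , cong centre (g-class Ov)

          A-T : ∀ {a} → A a → T a
          A-T (Oa , e) = subst T e (proj₁ (centre-spec (ℓ-∈-labels Oa)))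

          A-∉av : ∀ {a} → A a → a ∉ av
          A-∉av (Oa , e) = subst (_∉ av) e (proj₂ (proj₂ (centre-spec (ℓ-∈-labels Oa))))

          A-independent : ∀ {u v} → Red P u v → A u → A v → ⊥
          A-independent (inj₁ i) a b = independent i (A-T a) (A-T b)
          A-independent (inj₂ i) a b = independent i (A-T b) (A-T a)

          A-injective : ∀ {a b} → A a → A b → ℓ a ≡ ℓ b → a ≡ b
          A-injective (_ , e) (_ , e′) eq = trans (sym e) (trans (cong centre eq) e′)

          near-centre : ∀ {u v} → Red P u v → A u → v ≢ x → Out v
          near-centre {u} {v} i Au v≢x with Out? v
          ... | yes Ov = Ov
          ... | no ¬Ov = contradiction (inner (Red-∈ʳ i) v≢x ¬Ov i) (A-∉av Au)

          impossible : ⊥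
          impossible = no-transversal x≢y (length≢2 ∘ Next-ends) proj₁ g g-class A? proj₁ A-g A-injective
            A-independent near-centre y-Out

        absurd : ⊥
        absurd = go (transversal Class hall unique labels uniqueLabels labels-Class)
          where
          go : (∃ λ (T : Fin n → Set) → (∀ {j} → j ∈ labels → ∃ λ v → v ∈ P × T v × τ j v ≡ true) ×
            (∀ {u v} → Next P u v → T u → T v → ⊥)) → ⊥
          go (T , meets , independent) = impossible T meets independent

    usable-contradiction : ∀ av → length av ≤ 2 → Out y →
      (∀ {u v} → v ∈ P → v ≢ x → ¬ Out v → Red P u v → u ∈ av) → ⊥
    usable-contradiction av av≤2 Oy inner = ¬¬-Fin (λ u → ¬¬-Fin (λ w → ¬¬-excluded-middle))
      λ walk? → Classes.Avoiding.absurd walk? av av≤2 Oy inner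

-- Bound vertices and the ends of the path

module FewBound {n : ℕ} (G : Graph n) (cubic : Cubic G) (conn : KConnected 3 G) where

  open InGraph G cubic

  Internal : Fin n → Fin n → List (Fin n) → Fin n → Set
  Internal x y P v = v ∈ P × v ≢ x × v ≢ y

  Bound? : ∀ P v → Dec (Bound G P v)
  Bound? P v = Finₚ.all? (λ u → Adj? v u →-dec (u ∈? P))

  Internal? : ∀ x y P v → Dec (Internal x y P v)
  Internal? x y P v = (v ∈? P) ×-dec (¬? (v Finₚ.≟ x) ×-dec ¬? (v Finₚ.≟ y))

  module _ {x y : Fin n} (x≢y : x ≢ y) (xy : Adj G x y) {P : List (Fin n)} (long : Longest x y P) where

    open LongPath conn x≢y xy long using (Out; Out?; ¬Out⇒Bound; chord-Bound; usable-contradiction; Red-Adj)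
    open Longest long

    -- Besides `x` and its predecessor, `y` has a third neighbour. Outside P it makes `y` attached;
    -- on P it is internal and has a chord, hence is bound.
    last-Out : (∀ {t} → Internal x y P t → Bound G P t → Adj G y t → ¬ Red P y t → ⊥) → Out y
    last-Out h
      with r , i ← Path-pred path (Path-∈-last path) (x≢y ∘ sym)
      with t , yt , t≢x , t≢r ← third-neighbour y x r
      with t ∈? P
    ... | no t∉ = Path-∈-last path , t , t∉ , yt
    ... | yes t∈ = ⊥-elim (h int (chord-Bound int (Adj-sym yt) (Path-∈-last path) ¬red) yt ¬red)
      where
      int = t∈ , t≢x , λ { refl → Adj-irrefl yt }
      ¬red : ¬ Red P y t
      ¬red (inj₁ j) = Path-no-succ unique path j
      ¬red (inj₂ j) = t≢r (Next-injective unique j i)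

    no-Bound : ¬ (∀ {v} → Internal x y P v → ¬ Bound G P v)
    no-Bound none = usable-contradiction [] z≤n y-Out inner
      where
      y-Out : Out y
      y-Out = last-Out (λ int b _ _ → none int b)
      inner : ∀ {u v} → v ∈ P → v ≢ x → ¬ Out v → Red P u v → u ∈ []
      inner {_} {v} v∈ v≢x ¬Ov _ = contradiction (¬Out⇒Bound v∈ ¬Ov)
        (none (v∈ , v≢x , λ { refl → ¬Ov y-Out }))

    -- If `y` were not attached, its third neighbour would be bound, thus `z`, which would have four
    -- neighbours: `x`, `y` and the two along P. These last two are the vertices forbidden as
    -- centres.
    Bound-adjacent-x : ∀ {z} → Internal x y P z → Adj G z x → ¬ Red P z x →
      ¬ (∀ {v} → Internal x y P v → Bound G P v → v ≡ z)
    Bound-adjacent-x {z} (z∈ , z≢x , z≢y) zx chord only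
      with r , i ← Path-pred path z∈ z≢x
      with s , j ← Path-succ path z∈ z≢y
      = usable-contradiction (r ∷ s ∷ []) (s≤s (s≤s z≤n)) y-Out inner
      where
      y-Out : Out y
      y-Out = last-Out λ int b yt ¬red → case only int b of λ { refl →
        at-most-three zx (Adj-sym yt) (Red-Adj (inj₂ i)) (Red-Adj (inj₁ j)) x≢y
          (λ { refl → chord (inj₂ i) }) (λ { refl → chord (inj₁ j) })
          (λ { refl → ¬red (inj₁ i) }) (λ { refl → ¬red (inj₂ j) }) (λ { refl → Next-asym unique i j }) }
      inner : ∀ {u v} → v ∈ P → v ≢ x → ¬ Out v → Red P u v → u ∈ r ∷ s ∷ []
      inner {_} {v} v∈ v≢x ¬Ov red
        with only (v∈ , v≢x , λ { refl → ¬Ov y-Out }) (¬Out⇒Bound v∈ ¬Ov) | red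
      ... | refl | inj₁ k = here (Next-injective unique k i)
      ... | refl | inj₂ k = there (here (Next-functional unique k j))

  -- The third neighbour `w` of a bound vertex `z` lies on P. An internal `w` would be bound by its
  -- chord to `z`, hence equal to `z`. So `w` is an end, and reversing P reduces `y` to `x`.
  at-most-one-Bound : ∀ {x y P} → x ≢ y → Adj G x y → Longest x y P →
    ¬ (∀ {u v} → Internal x y P u → Internal x y P v → Bound G P u → Bound G P v → u ≡ v)
  at-most-one-Bound {x} {y} {P} x≢y xy long same
    with Finₚ.any? (λ z → Internal? x y P z ×-dec Bound? P z)
  ... | no none = no-Bound x≢y xy long (λ int b → none (_ , int , b))
  ... | yes (z , int@(z∈ , z≢x , z≢y) , b)
    with r , i ← Path-pred (Longest.path long) z∈ z≢x
    with s , j ← Path-succ (Longest.path long) z∈ z≢y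
    with w , zw , w≢r , w≢s ← third-neighbour z r s
    = go (w Finₚ.≟ x) (w Finₚ.≟ y)
    where
    open Longest long
    ¬red : ¬ Red P z w
    ¬red (inj₁ k) = w≢s (Next-functional unique k j)
    ¬red (inj₂ k) = w≢r (Next-injective unique k i)
    reversed : ∀ {v} → v ∈ reverse P → v ∈ P
    reversed = Anyₚ.reverse⁻
    go : Dec (w ≡ x) → Dec (w ≡ y) → ⊥
    go (yes refl) _ = Bound-adjacent-x x≢y xy long int zw ¬red (λ int′ b′ → same int′ int b′ b)
    go _ (yes refl) = Bound-adjacent-x (x≢y ∘ sym) (Adj-sym xy) (Longest-reverse long)
      (Anyₚ.reverse⁺ z∈ , z≢y , z≢x) zw
      (λ red → ¬red (subst (λ l → Red l z y) (Listₚ.reverse-involutive P) (Red-reverse red)))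
      (λ { (v∈ , v≢y , v≢x) b′ → same (reversed v∈ , v≢x , v≢y) int (λ u vu → reversed (b′ u vu)) b })
    go (no w≢x) (no w≢y) = Adj-irrefl (subst (Adj G z) (same (b w zw , w≢x , w≢y) int
      (LongPath.chord-Bound conn x≢y xy long (b w zw , w≢x , w≢y) (Adj-sym zw) z∈ ¬red) b) zw)

theorem1p6 : ∀ {n} (G : Graph n) → Cubic G → KConnected 3 G →
    ∀ (x y : Fin n) → x ≢ y → Adj G x y →
    ∀ (mid : List (Fin n)) → IsLongestPath G x mid y →
    ∃₂ λ u v → u ≢ v × u ∈ mid × v ∈ mid
    × Bound G (pathVerts x mid y) u × Bound G (pathVerts x mid y) v
theorem1p6 {n} G cubic conn x y x≢y xy mid ((uP , linked) , longest) =
  select (filter (Bound? P) mid) refl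
  where
  open InGraph G cubic
  open FewBound G cubic conn
  P : List (Fin n)
  P = pathVerts x mid y

  ∈-mid : ∀ {v} → Internal x y P v → v ∈ mid
  ∈-mid (here refl , v≢x , _) = contradiction refl v≢x
  ∈-mid (there i , _ , v≢y) with ∈ₚ.∈-++⁻ mid i
  ... | inj₁ j           = j
  ... | inj₂ (here refl) = contradiction refl v≢y

  long : Longest x y P
  long = record { path = Linked⇒Path mid linked ; unique = uP ; longest = longer }
    where
    longer : ∀ {Q} → Path (Adj G) x y Q → Unique Q → length Q ≤ length P
    longer stop    _  = contradiction refl x≢y
    longer (e ▸ q) uQ with Q , refl ← Path-last q =
      s≤s (subst₂ _≤_ (size Q) (size mid) (longest Q (uQ , Path⇒Linked (e ▸ q))))
      where
      size : ∀ l → suc (length l) ≡ length (l ++ [ y ])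
      size l = sym (trans (Listₚ.length-++ l) (ℕₚ.+-comm (length l) 1))

  Bound-∈ : ∀ {v} → Internal x y P v → Bound G P v → v ∈ filter (Bound? P) mid
  Bound-∈ int b = ∈ₚ.∈-filter⁺ (Bound? P) (∈-mid int) b

  select : ∀ bs → bs ≡ filter (Bound? P) mid →
    ∃₂ λ u v → u ≢ v × u ∈ mid × v ∈ mid × Bound G P u × Bound G P v
  select [] e = ⊥-elim (at-most-one-Bound x≢y xy long λ i _ b _ →
    case subst (_ ∈_) (sym e) (Bound-∈ i b) of λ ())
  select (z ∷ []) e = ⊥-elim (at-most-one-Bound x≢y xy long λ i j b c →
    trans (single (subst (_ ∈_) (sym e) (Bound-∈ i b))) (sym (single (subst (_ ∈_) (sym e) (Bound-∈ j c)))))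
    where
    single : ∀ {v} → v ∈ z ∷ [] → v ≡ z
    single (here eq) = eq
  select (u ∷ v ∷ bs) e
    with u∈ , bu ← ∈ₚ.∈-filter⁻ (Bound? P) {xs = mid} (subst (u ∈_) e (here refl))
    with v∈ , bv ← ∈ₚ.∈-filter⁻ (Bound? P) {xs = mid} (subst (v ∈_) e (there (here refl)))
    = u , v , (λ { refl → Unique-head uBs (here refl) }) , u∈ , v∈ , bu , bv
    where
    uMid : Unique mid
    uMid = Unique-tail (Unique-↭ (↭ₚ.++-comm mid [ y ]) (Unique-tail uP))
    uBs : Unique (u ∷ v ∷ bs)
    uBs = subst Unique (sym e) (Uniqueₚ.filter⁺ (Bound? P) uMid)
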